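{- Let $k,r$ be positive integers, $m_1,\dots,m_k\in\mathbb{N}$, $k_r\in\mathbb{N}$, $k_1,\dots,k_{r-1}\in\mathbb{N}_0$. Then \begin{align*} \zeta\left((k_r+1,\dots,k_1+1)\circledast(0,m_1+1,\dots,m_k+1)^\star\right)&=(-1)^k\sum_{j=1}^{k+1}\zeta\left(\mathbf{k}_r^v,\mathbf{m}_{j-1}^v\right)\sum_{l=1}^{k+1-j}(-1)^l\\ &\qquad\times\sum_{\substack{i_0<i_1<\cdots<i_l\\ i_0=j,\ i_l=k+1}}\prod_{h=1}^l\zeta\left(m_{i_h-1}+1,\dots,m_{i_{h-1}+1}+1,m_{i_{h-1}}+1\right), \end{align*} where the inner expression $\sum_{l=1}^{0}(\cdots)$ (the case $j=k+1$) is interpreted as $1$, $\mathbf{k}_r^v=\big(2\Box\{1\}_{k_1-1}\Box2\Box\cdots\Box2\Box\{1\}_{k_{r-1}-1}\Box2,\{1\}_{k_r-1}\big)$, $\mathbf m_{q}^v=(2,\{1\}_{m_1-1},2,\{1\}_{m_2-1},\dots,2,\{1\}_{m_q-1})$ for $q\ge1$, and $\mathbf m_0^v=\emptyset$.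
   Context: Multiple zeta values $\zeta(s_1,\dots,s_r)=\sum_{n_1>\cdots>n_r\ge1}n_1^{ -s_1}\cdots n_r^{ -s_r}$ ($s_1\ge2$); $\zeta_n(s_1,\dots,s_r)=\sum_{n\ge n_1>\cdots>n_r\ge1}\prod n_j^{ -s_j}$, $\zeta^\star_n(s_1,\dots,s_r)=\sum_{n\ge n_1\ge\cdots\ge n_r\ge1}\prod n_j^{ -s_j}$ (both $1$ for empty index). $\{1\}_d$: $d$ entries $1$ (empty if $d=0$). Box convention: $u\,\Box\,\{1\}_{q-1}\,\Box\,v$ is $u,\{1\}_{q-1},v$ if $q\ge1$ and the single entry $u+v-1$ if $q=0$ (repeatedly for consecutive zeros). Kaneko–Yamamoto value: $\zeta\left((k_r+1,\dots,k_1+1)\circledast(0,l_1,\dots,l_s)^\star\right)=\sum_{n\ge1}\frac{\zeta_{n-1}(k_{r-1}+1,\dots,k_1+1)\zeta^\star_n(l_1,\dots,l_s)}{n^{k_r+1}}$. -}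

module Defs where

open import Data.Nat as ℕ using (ℕ; zero; suc; _∸_; _^_; _<ᵇ_; _≡ᵇ_)
open import Data.Nat.Properties using (m^n≢0)
open import Data.Integer using (+_)
open import Data.Bool using (if_then_else_)
open import Data.List using (List; []; _∷_; _++_; map; concatMap; replicate; reverse)
open import Data.Rational using (ℚ; _+_; _*_; _-_; -_; _/_; 0ℚ; 1ℚ)

sumFromTo : ℕ → ℕ → (ℕ → ℚ) → ℚ
sumFromTo a b f = go (suc b ∸ a) a
  where
  go : ℕ → ℕ → ℚ
  go zero    i = 0ℚ
  go (suc c) i = f i + go c (suc i)

range : ℕ → ℕ → List ℕ
range a b = go (suc b ∸ a) a
  where
  go : ℕ → ℕ → List ℕ
  go zero    i = []
  go (suc c) i = i ∷ go c (suc i)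

sumList : List ℚ → ℚ
sumList []       = 0ℚ
sumList (x ∷ xs) = x + sumList xs

prodList : List ℚ → ℚ
prodList []       = 1ℚ
prodList (x ∷ xs) = x * prodList xs

sign : ℕ → ℚ
sign zero    = 1ℚ
sign (suc n) = - sign n

invPow : ℕ → ℕ → ℚ
invPow i s = (+ 1) / (suc i ^ s)
  where instance _ = m^n≢0 (suc i) s

-- ζ_n(s₁,…,s_r) = Σ_{n ≥ n₁ > ⋯ > n_r ≥ 1} ∏ n_j^{-s_j}  (1 for empty index)
zetaN : ℕ → List ℕ → ℚ
zetaN n []       = 1ℚ
zetaN n (s ∷ ss) = sumFromTo 1 n (λ m → invPow (m ∸ 1) s * zetaN (m ∸ 1) ss)

-- ζ*_n(s₁,…,s_r) = Σ_{n ≥ n₁ ≥ ⋯ ≥ n_r ≥ 1} ∏ n_j^{-s_j}  (1 for empty index)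
zetaStarN : ℕ → List ℕ → ℚ
zetaStarN n []       = 1ℚ
zetaStarN n (s ∷ ss) = sumFromTo 1 n (λ m → invPow (m ∸ 1) s * zetaStarN m ss)

-- The multiple zeta value ζ(s) is the limit of zetaN N s as N → ∞.

-- Kaneko–Yamamoto value, truncated at N:
--   Σ_{n=1}^{N} ζ_{n-1}(k_{r-1}+1,…,k_1+1) ζ*_n(l_1,…,l_s) / n^{k_r+1}
-- ks = [k_1,…,k_{r-1}], kr = k_r, ls = [l_1,…,l_s]
kyN : ℕ → List ℕ → ℕ → List ℕ → ℚ
kyN N ks kr ls =
  sumFromTo 1 N (λ n → zetaN (n ∸ 1) (reverse (map suc ks)) * zetaStarN n ls
                       * invPow (n ∸ 1) (suc kr))

ones : ℕ → List ℕ
ones d = replicate d 1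

-- 2 □ {1}_{q₁-1} □ 2 □ ⋯ □ {1}_{q_t-1} □ 2, with the box convention;
-- the first argument is the current (still open) entry u.
boxAux : ℕ → List ℕ → List ℕ
boxAux u []            = u ∷ []
boxAux u (zero  ∷ qs)  = boxAux (suc u) qs        -- u □ {1}_{-1} □ 2 = u + 1
boxAux u (suc q ∷ qs)  = u ∷ (ones q ++ boxAux 2 qs)

kV : List ℕ → ℕ → List ℕ
kV ks kr = boxAux 2 ks ++ ones (kr ∸ 1)

-- m_q^v = (2,{1}_{m_1-1},…,2,{1}_{m_q-1}),  m_0^v = ∅   (m is 1-based)
mV : (ℕ → ℕ) → ℕ → List ℕ
mV m q = concatMap (λ i → 2 ∷ ones (m i ∸ 1)) (range 1 q)

mBlock : (ℕ → ℕ) → ℕ → ℕ → List ℕ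
mBlock m a b = reverse (map (λ t → suc (m t)) (range a (b ∸ 1)))

-- Chains: chains j K l = all (i₁,…,i_l) with j = i₀ < i₁ < ⋯ < i_l = K
chains : ℕ → ℕ → ℕ → List (List ℕ)
chains j K zero    = if j ≡ᵇ K then [] ∷ [] else []
chains j K (suc l) = concatMap (λ i → map (i ∷_) (chains i K l)) (range (suc j) K)

chainProdN : ℕ → (ℕ → ℕ) → ℕ → List ℕ → ℚ
chainProdN N m i₀ []       = 1ℚ
chainProdN N m i₀ (i ∷ is) = zetaN N (mBlock m i₀ i) * chainProdN N m i is

innerN : ℕ → ℕ → (ℕ → ℕ) → ℕ → ℚ
innerN N k m j =
  if j ≡ᵇ suc k then 1ℚ
  else sumFromTo 1 (suc k ∸ j) (λ l →
         sign l * sumList (map (chainProdN N m j) (chains j (suc k) l)))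

rhsN : ℕ → List ℕ → ℕ → ℕ → (ℕ → ℕ) → ℚ
rhsN N ks kr k m =
  sign k * sumFromTo 1 (suc k) (λ j →
    zetaN N (kV ks kr ++ mV m (j ∸ 1)) * innerN N k m j)

lhsN : ℕ → List ℕ → ℕ → ℕ → (ℕ → ℕ) → ℚ
lhsN N ks kr k m = kyN N ks kr (map (λ i → suc (m i)) (range 1 k))

{-# OPTIONS --safe #-}
-- Expanding ζ*_n(m₁+1,…,m_k+1) by repeatedly replacing the condition n₁ ≤ n with "no condition"
-- minus "n₁ > n" turns the truncated Kaneko–Yamamoto sum into
--   Σ_i (-1)^i ζ_N(m_i+1,…,m₁+1,k_r+1,…,k₁+1) ζ*_N(m_{i+1}+1,…,m_k+1),
-- and the same expansion with an empty first index shows that the sum over chains is ±ζ*_N.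
-- So for every N the two sides differ only by replacing an index with its dual. That replacement
-- is handled by the connected sums of Seki and Yamamoto, truncated at N: each transport step costs
-- an error O(log^d N / N), and ζ*_N grows at most like a power of log N.
module Submission where

open import Defs
open import Data.Bool using (true; false)
open import Data.Nat as ℕ using (ℕ; zero; suc; _∸_; _≤_; _≥_; _≡ᵇ_; z≤n; s≤s; NonZero)
import Data.Nat.Properties as ℕₚ
open import Data.Integer as ℤ using () renaming (+_ to pos)
import Data.Integer.Properties as ℤₚ
open import Data.List using (List; []; _∷_; _++_; map; concatMap; replicate; reverse; length)
import Data.List.Properties as Listₚ
open import Data.List.Relation.Unary.All as All using (All; []; _∷_)
import Data.List.Relation.Unary.All.Properties as Allₚ
open import Data.Product using (∃; _×_; _,_)
open import Data.Rational using (ℚ; mkℚ; 0ℚ; 1ℚ; _<_; _+_; _*_; _-_; -_; _/_; 1/_; ∣_∣; toℚᵘ; nonNegative; positive)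
  renaming (_≤_ to _≤ℚ_)
open import Data.Rational.Properties
open import Data.Rational.Solver using (module +-*-Solver)
open import Data.Rational.Unnormalised as ℚᵘ using (mkℚᵘ; *≡*)
import Data.Rational.Unnormalised.Properties as ℚᵘₚ
open import Data.Sum using (inj₁; inj₂)
open import Relation.Binary.PropositionalEquality
open import Relation.Nullary using (yes; no; contradiction)
open +-*-Solver using (solve; _:+_; _:*_; _:-_; :-_; _:=_; con)

-- A rate is needed and not just a limit: while letters move from a word to its dual, intermediate
-- words begin with `y`, and their truncated sums diverge like powers of log N. They multiply the
-- connector at the boundary n = N, which is at most 1/(N+1) and wins. The logarithm is replaced by
-- the rational `harm`, whose powers are compared with N by induction on the exponent. The box
-- convention needs no treatment of its own. Under duality an entry q+1, the block x^q y, becomes x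
-- y^q; for q = 0 this is a bare x, which merges with the following block and raises its first entry
-- by one.

-- Finite sums

∑ : ℕ → (ℕ → ℚ) → ℚ
∑ zero    f = 0ℚ
∑ (suc n) f = ∑ n f + f n

∑-cong< : ∀ n {f g} → (∀ i → i ℕ.< n → f i ≡ g i) → ∑ n f ≡ ∑ n g
∑-cong< zero    e = refl
∑-cong< (suc n) e =
  cong₂ _+_ (∑-cong< n (λ i i<n → e i (ℕₚ.m<n⇒m<1+n i<n))) (e n (ℕₚ.n<1+n n))

∑-cong : ∀ n {f g} → (∀ i → f i ≡ g i) → ∑ n f ≡ ∑ n g
∑-cong n e = ∑-cong< n (λ i _ → e i)

∑-zero : ∀ n → ∑ n (λ _ → 0ℚ) ≡ 0ℚ
∑-zero zero    = refl
∑-zero (suc n) = trans (+-identityʳ _) (∑-zero n)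

∑-distrib-+ : ∀ n f g → ∑ n (λ i → f i + g i) ≡ ∑ n f + ∑ n g
∑-distrib-+ zero    f g = refl
∑-distrib-+ (suc n) f g = trans (cong (_+ (f n + g n)) (∑-distrib-+ n f g))
  (solve 4 (λ a b c d → (a :+ b) :+ (c :+ d) := (a :+ c) :+ (b :+ d)) refl
    (∑ n f) (∑ n g) (f n) (g n))

*-distribˡ-∑ : ∀ n c f → c * ∑ n f ≡ ∑ n (λ i → c * f i)
*-distribˡ-∑ zero    c f = *-zeroʳ c
*-distribˡ-∑ (suc n) c f =
  trans (*-distribˡ-+ c (∑ n f) (f n)) (cong (_+ c * f n) (*-distribˡ-∑ n c f))

*-distribʳ-∑ : ∀ n c f → ∑ n f * c ≡ ∑ n (λ i → f i * c)
*-distribʳ-∑ n c f = trans (*-comm (∑ n f) c)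
  (trans (*-distribˡ-∑ n c f) (∑-cong n (λ i → *-comm c (f i))))

neg-distrib-∑ : ∀ n f → - ∑ n f ≡ ∑ n (λ i → - f i)
neg-distrib-∑ zero    f = refl
neg-distrib-∑ (suc n) f =
  trans (neg-distrib-+ (∑ n f) (f n)) (cong (_+ - f n) (neg-distrib-∑ n f))

∑-distrib-- : ∀ n f g → ∑ n (λ i → f i - g i) ≡ ∑ n f - ∑ n g
∑-distrib-- n f g =
  trans (∑-distrib-+ n f (λ i → - g i)) (cong (∑ n f +_) (sym (neg-distrib-∑ n g)))

∑-comm : ∀ a b (f : ℕ → ℕ → ℚ) → ∑ a (λ i → ∑ b (f i)) ≡ ∑ b (λ j → ∑ a (λ i → f i j))
∑-comm zero    b f = sym (∑-zero b)
∑-comm (suc a) b f = trans (cong (_+ ∑ b (f a)) (∑-comm a b f))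
  (sym (∑-distrib-+ b (λ j → ∑ a (λ i → f i j)) (f a)))

∑-head : ∀ n f → ∑ (suc n) f ≡ f 0 + ∑ n (λ i → f (suc i))
∑-head zero    f = trans (+-identityˡ (f 0)) (sym (+-identityʳ (f 0)))
∑-head (suc n) f = trans (cong (_+ f (suc n)) (∑-head n f))
  (+-assoc (f 0) (∑ n (λ i → f (suc i))) (f (suc n)))

∑-mono-≤ : ∀ n {f g} → (∀ i → i ℕ.< n → f i ≤ℚ g i) → ∑ n f ≤ℚ ∑ n g
∑-mono-≤ zero    le = ≤-refl
∑-mono-≤ (suc n) le =
  +-mono-≤ (∑-mono-≤ n (λ i i<n → le i (ℕₚ.m<n⇒m<1+n i<n))) (le n (ℕₚ.n<1+n n))

∑-nonneg : ∀ n {f} → (∀ i → 0ℚ ≤ℚ f i) → 0ℚ ≤ℚ ∑ n f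
∑-nonneg n {f} le = subst (_≤ℚ ∑ n f) (∑-zero n) (∑-mono-≤ n (λ i _ → le i))

-- The square of index pairs is cut along its diagonal: the first sum has the `g`-index at most the
-- `f`-index, the second has it strictly larger, so the diagonal counts once.
∑-by-parts : ∀ M f g →
  ∑ M (λ n → f n * ∑ (suc n) g) + ∑ M (λ n → g n * ∑ n f) ≡ ∑ M f * ∑ M g
∑-by-parts zero    f g = refl
∑-by-parts (suc M) f g = trans
  (solve 6 (λ P Q F G a b → (P :+ a :* (G :+ b)) :+ (Q :+ b :* F)
                         := (P :+ Q) :+ (a :* G :+ a :* b :+ b :* F)) refl
    (∑ M (λ n → f n * ∑ (suc n) g)) (∑ M (λ n → g n * ∑ n f)) (∑ M f) (∑ M g) (f M) (g M))
  (trans (cong (_+ (f M * ∑ M g + f M * g M + g M * ∑ M f)) (∑-by-parts M f g))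
  (solve 4 (λ F G a b → F :* G :+ (a :* G :+ a :* b :+ b :* F) := (F :+ a) :* (G :+ b)) refl
    (∑ M f) (∑ M g) (f M) (g M)))

-- The local worker of `sumFromTo` recurses on the number of terms; carrying that number as `c` with
-- an equation lets rewriting unfold it.
sumFromTo-∑ : ∀ c a b f → suc b ∸ a ≡ c → sumFromTo a b f ≡ ∑ c (λ i → f (a ℕ.+ i))
sumFromTo-∑ zero    a b f e rewrite e = refl
sumFromTo-∑ (suc c) a b f e = trans (step a b c f e e′) (trans
  (cong₂ _+_ (cong f (sym (ℕₚ.+-identityʳ a)))
    (trans (sumFromTo-∑ c (suc a) b f e′) (∑-cong c (λ i → cong f (sym (ℕₚ.+-suc a i))))))
  (sym (∑-head c (λ i → f (a ℕ.+ i)))))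
  where
  e′ : b ∸ a ≡ c
  e′ = trans (sym (ℕₚ.pred[m∸n]≡m∸[1+n] (suc b) a)) (cong ℕ.pred e)
  step : ∀ a b c f → suc b ∸ a ≡ suc c → b ∸ a ≡ c → sumFromTo a b f ≡ f a + sumFromTo (suc a) b f
  step a b c f e e′ rewrite e | e′ = refl

interval : ℕ → ℕ → List ℕ
interval a zero    = []
interval a (suc c) = a ∷ interval (suc a) c

range-interval : ∀ c a b → suc b ∸ a ≡ c → range a b ≡ interval a c
range-interval zero    a b e rewrite e = refl
range-interval (suc c) a b e = trans (step a b c e e′) (cong (a ∷_) (range-interval c (suc a) b e′))
  where
  e′ : b ∸ a ≡ c
  e′ = trans (sym (ℕₚ.pred[m∸n]≡m∸[1+n] (suc b) a)) (cong ℕ.pred e)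
  step : ∀ a b c → suc b ∸ a ≡ suc c → b ∸ a ≡ c → range a b ≡ a ∷ range (suc a) b
  step a b c e e′ rewrite e | e′ = refl

-- Rational arithmetic with 1/n

-- invPow reindexed by the base, with the junk value 0 at base 0.
ip : ℕ → ℕ → ℚ
ip zero    s = 0ℚ
ip (suc i) s = invPow i s

rec : ℕ → ℚ
rec n = ip n 1

ι : ℕ → ℚ
ι n = pos n / 1

private
  1/ᵘ : ∀ n .{{_ : NonZero n}} → toℚᵘ (pos 1 / n) ℚᵘ.≃ (pos 1 ℚᵘ./ n)
  1/ᵘ (suc n) = toℚᵘ-fromℚᵘ (mkℚᵘ (pos 1) n)

  ιᵘ : ∀ n → toℚᵘ (ι n) ℚᵘ.≃ (pos n ℚᵘ./ 1)
  ιᵘ n = toℚᵘ-fromℚᵘ (mkℚᵘ (pos n) 0)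

1/-* : ∀ a b c .{{_ : NonZero a}} .{{_ : NonZero b}} .{{_ : NonZero c}} →
  a ≡ b ℕ.* c → pos 1 / a ≡ (pos 1 / b) * (pos 1 / c)
1/-* a@(suc _) b@(suc _) c@(suc _) e = toℚᵘ-injective (begin
  toℚᵘ (pos 1 / a)                          ≈⟨ 1/ᵘ a ⟩
  pos 1 ℚᵘ./ a                              ≈⟨ *≡* (cong (λ t → pos 1 ℤ.* pos t) (sym e)) ⟩
  (pos 1 ℚᵘ./ b) ℚᵘ.* (pos 1 ℚᵘ./ c)          ≈⟨ ℚᵘₚ.*-cong (1/ᵘ b) (1/ᵘ c) ⟨
  toℚᵘ (pos 1 / b) ℚᵘ.* toℚᵘ (pos 1 / c)      ≈⟨ toℚᵘ-homo-* (pos 1 / b) (pos 1 / c) ⟨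
  toℚᵘ ((pos 1 / b) * (pos 1 / c))            ∎)
  where open ℚᵘₚ.≃-Reasoning

ip-suc : ∀ n s → ip n (suc s) ≡ rec n * ip n s
ip-suc zero    s = refl
ip-suc (suc i) s = 1/-* (suc i ℕ.^ suc s) (suc i ℕ.^ 1) (suc i ℕ.^ s)
  {{ℕₚ.m^n≢0 (suc i) (suc s)}} {{ℕₚ.m^n≢0 (suc i) 1}} {{ℕₚ.m^n≢0 (suc i) s}}
  (cong (ℕ._* suc i ℕ.^ s) (sym (ℕₚ.*-identityʳ (suc i))))

ip-nonneg : ∀ n s → 0ℚ ≤ℚ ip n s
ip-nonneg zero    s = ≤-refl
ip-nonneg (suc i) s = nonNegative⁻¹ _ {{normalize-nonNeg 1 (suc i ℕ.^ s) {{ℕₚ.m^n≢0 (suc i) s}}}}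

ι-suc : ∀ n → ι (suc n) ≡ ι n + 1ℚ
ι-suc n = toℚᵘ-injective (begin
  toℚᵘ (ι (suc n))              ≈⟨ ιᵘ (suc n) ⟩
  pos (suc n) ℚᵘ./ 1                ≈⟨ *≡* (cong (ℤ._* pos 1) (trans (cong pos (ℕₚ.+-comm 1 n))
                                     (cong (ℤ._+ pos 1) (sym (ℤₚ.*-identityʳ (pos n)))))) ⟩
  (pos n ℚᵘ./ 1) ℚᵘ.+ toℚᵘ 1ℚ     ≈⟨ ℚᵘₚ.+-congˡ _ (ιᵘ n) ⟨
  toℚᵘ (ι n) ℚᵘ.+ toℚᵘ 1ℚ       ≈⟨ toℚᵘ-homo-+ (ι n) 1ℚ ⟨
  toℚᵘ (ι n + 1ℚ)               ∎)
  where open ℚᵘₚ.≃-Reasoning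

ι-rec : ∀ n → ι (suc n) * rec (suc n) ≡ 1ℚ
ι-rec n = toℚᵘ-injective (begin
  toℚᵘ (ι (suc n) * rec (suc n))                ≈⟨ toℚᵘ-homo-* (ι (suc n)) (rec (suc n)) ⟩
  toℚᵘ (ι (suc n)) ℚᵘ.* toℚᵘ (rec (suc n))      ≈⟨ ℚᵘₚ.*-cong (ιᵘ (suc n)) (1/ᵘ (suc n ℕ.* 1)) ⟩
  (pos (suc n) ℚᵘ./ 1) ℚᵘ.* (pos 1 ℚᵘ./ (suc n ℕ.* 1)) ≈⟨ *≡* (trans (ℤₚ.*-identityʳ _)
     (trans (ℤₚ.*-identityʳ (pos (suc n))) (cong pos (sym (trans (ℕₚ.*-identityˡ _) (trans (ℕₚ.*-identityˡ _) (ℕₚ.*-identityʳ (suc n)))))))) ⟩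
  toℚᵘ 1ℚ                                       ∎)
  where open ℚᵘₚ.≃-Reasoning

ι-+ : ∀ a b → ι (a ℕ.+ b) ≡ ι a + ι b
ι-+ zero    b = sym (+-identityˡ (ι b))
ι-+ (suc a) b = trans (ι-suc (a ℕ.+ b)) (trans (cong (_+ 1ℚ) (ι-+ a b)) (trans
  (solve 3 (λ x y z → (x :+ y) :+ z := (x :+ z) :+ y) refl (ι a) (ι b) 1ℚ)
  (cong (_+ ι b) (sym (ι-suc a)))))

ι-nonneg : ∀ n → 0ℚ ≤ℚ ι n
ι-nonneg n = nonNegative⁻¹ (ι n) {{normalize-nonNeg n 1}}

archimedean : ∀ q → ∃ λ n → q ≤ℚ ι n
archimedean q@(mkℚ a d _) = ℤ.∣ a ∣ , toℚᵘ-cancel-≤ (ℚᵘₚ.≤-respʳ-≃ (ℚᵘₚ.≃-sym (ιᵘ ℤ.∣ a ∣))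
  (ℚᵘ.*≤* (begin
    a ℤ.* pos 1                  ≡⟨ ℤₚ.*-identityʳ a ⟩
    a                          ≤⟨ i≤∣i∣ a ⟩
    pos ℤ.∣ a ∣                  ≡⟨ ℤₚ.*-identityʳ (pos ℤ.∣ a ∣) ⟨
    pos ℤ.∣ a ∣ ℤ.* pos 1          ≤⟨ ℤₚ.*-monoˡ-≤-nonNeg (pos ℤ.∣ a ∣) (ℤ.+≤+ (s≤s z≤n)) ⟩
    pos ℤ.∣ a ∣ ℤ.* pos (suc d)      ∎)))
  where
  open ℤₚ.≤-Reasoning
  i≤∣i∣ : ∀ i → i ℤ.≤ pos ℤ.∣ i ∣
  i≤∣i∣ (pos n)          = ℤₚ.≤-refl
  i≤∣i∣ (ℤ.-[1+ n ])   = ℤ.-≤+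

*-monoˡ-≤ : ∀ {r p q} → 0ℚ ≤ℚ r → p ≤ℚ q → r * p ≤ℚ r * q
*-monoˡ-≤ {r} 0≤r = *-monoˡ-≤-nonNeg r {{nonNegative 0≤r}}

*-monoʳ-≤ : ∀ {r p q} → 0ℚ ≤ℚ r → p ≤ℚ q → p * r ≤ℚ q * r
*-monoʳ-≤ {r} 0≤r = *-monoʳ-≤-nonNeg r {{nonNegative 0≤r}}

*-mono-≤ : ∀ {p q r s} → 0ℚ ≤ℚ p → 0ℚ ≤ℚ s → p ≤ℚ q → r ≤ℚ s → p * r ≤ℚ q * s
*-mono-≤ 0≤p 0≤s p≤q r≤s = ≤-trans (*-monoˡ-≤ 0≤p r≤s) (*-monoʳ-≤ 0≤s p≤q)

*-nonneg : ∀ {p q} → 0ℚ ≤ℚ p → 0ℚ ≤ℚ q → 0ℚ ≤ℚ p * q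
*-nonneg {p} {q} 0≤p 0≤q = subst (_≤ℚ p * q) (*-zeroʳ p) (*-monoˡ-≤ 0≤p 0≤q)

+-nonneg : ∀ {p q} → 0ℚ ≤ℚ p → 0ℚ ≤ℚ q → 0ℚ ≤ℚ p + q
+-nonneg = +-mono-≤

p≤p+q : ∀ {p q} → 0ℚ ≤ℚ q → p ≤ℚ p + q
p≤p+q {p} {q} 0≤q = subst (_≤ℚ p + q) (+-identityʳ p) (+-monoʳ-≤ p 0≤q)

0≤1 : 0ℚ ≤ℚ 1ℚ
0≤1 = nonNegative⁻¹ 1ℚ

infixr 8 _↑_
_↑_ : ℚ → ℕ → ℚ
p ↑ zero  = 1ℚ
p ↑ suc d = p * p ↑ d

↑-nonneg : ∀ {p} d → 0ℚ ≤ℚ p → 0ℚ ≤ℚ p ↑ d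
↑-nonneg zero    0≤p = 0≤1
↑-nonneg (suc d) 0≤p = *-nonneg 0≤p (↑-nonneg d 0≤p)

↑-+ : ∀ p d e → p ↑ (d ℕ.+ e) ≡ p ↑ d * p ↑ e
↑-+ p zero    e = sym (*-identityˡ (p ↑ e))
↑-+ p (suc d) e = trans (cong (p *_) (↑-+ p d e)) (sym (*-assoc p (p ↑ d) (p ↑ e)))

1≤↑ : ∀ {p} d → 1ℚ ≤ℚ p → 1ℚ ≤ℚ p ↑ d
1≤↑ zero    1≤p = ≤-refl
1≤↑ {p} (suc d) 1≤p = *-mono-≤ {1ℚ} {p} {1ℚ} {p ↑ d} 0≤1 (≤-trans 0≤1 (1≤↑ d 1≤p)) 1≤p (1≤↑ d 1≤p)

-- The difference of the two powers is b times a sum of d+1 monomials, each at most (a+b)^d.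
↑-increment : ∀ {a b} d → 0ℚ ≤ℚ a → 0ℚ ≤ℚ b →
  (a + b) ↑ suc d ≤ℚ a ↑ suc d + ι (suc d) * (b * (a + b) ↑ d)
↑-increment {a} {b} zero 0≤a 0≤b = ≤-reflexive
  (solve 2 (λ a b → (a :+ b) :* con 1ℚ := a :* con 1ℚ :+ con 1ℚ :* (b :* con 1ℚ)) refl a b)
↑-increment {a} {b} (suc d) 0≤a 0≤b = begin
  (a + b) * X                                       ≡⟨ *-distribʳ-+ X a b ⟩
  a * X + b * X
    ≤⟨ +-monoˡ-≤ (b * X) (*-monoˡ-≤ 0≤a (↑-increment d 0≤a 0≤b)) ⟩
  a * (a ↑ suc d + ι (suc d) * (b * Y)) + b * X
    ≡⟨ solve 6 (λ a A i b Y X → a :* (A :+ i :* (b :* Y)) :+ b :* X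
        := a :* A :+ (i :* (b :* (a :* Y)) :+ b :* X)) refl a (a ↑ suc d) (ι (suc d)) b Y X ⟩
  a ↑ suc (suc d) + (ι (suc d) * (b * (a * Y)) + b * X)
    ≤⟨ +-monoʳ-≤ (a ↑ suc (suc d)) (+-monoˡ-≤ (b * X) (*-monoˡ-≤ (ι-nonneg (suc d))
        (*-monoˡ-≤ 0≤b (*-monoʳ-≤ (↑-nonneg d (+-nonneg 0≤a 0≤b)) (p≤p+q {a} 0≤b))))) ⟩
  a ↑ suc (suc d) + (ι (suc d) * (b * X) + b * X)
    ≡⟨ cong (a ↑ suc (suc d) +_) (trans
        (solve 2 (λ i t → i :* t :+ t := (i :+ con 1ℚ) :* t) refl (ι (suc d)) (b * X))
        (cong (_* (b * X)) (sym (ι-suc (suc d))))) ⟩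
  a ↑ suc (suc d) + ι (suc (suc d)) * (b * X)       ∎
  where
  open ≤-Reasoning
  X = (a + b) ↑ suc d
  Y = (a + b) ↑ d

rec-nonneg : ∀ n → 0ℚ ≤ℚ rec n
rec-nonneg n = ip-nonneg n 1

rec≤1 : ∀ n → rec n ≤ℚ 1ℚ
rec≤1 zero    = 0≤1
rec≤1 (suc n) = begin
  rec (suc n)                        ≤⟨ p≤p+q (*-nonneg (ι-nonneg n) (rec-nonneg (suc n))) ⟩
  rec (suc n) + ι n * rec (suc n)
    ≡⟨ solve 2 (λ r i → r :+ i :* r := (i :+ con 1ℚ) :* r) refl (rec (suc n)) (ι n) ⟩
  (ι n + 1ℚ) * rec (suc n)           ≡⟨ cong (_* rec (suc n)) (ι-suc n) ⟨
  ι (suc n) * rec (suc n)            ≡⟨ ι-rec n ⟩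
  1ℚ                                 ∎
  where open ≤-Reasoning

-- Negligible sequences

-- The term at 0 is the junk value 0, so this is 1 + (1 + 1/2 + ⋯ + 1/N).
harm : ℕ → ℚ
harm N = 1ℚ + ∑ (suc N) rec

1≤harm : ∀ N → 1ℚ ≤ℚ harm N
1≤harm N = p≤p+q (∑-nonneg (suc N) rec-nonneg)

harm-nonneg : ∀ N → 0ℚ ≤ℚ harm N
harm-nonneg N = ≤-trans 0≤1 (1≤harm N)

∑rec≤harm : ∀ N → ∑ (suc N) rec ≤ℚ harm N
∑rec≤harm N = subst (_≤ℚ harm N) (+-identityˡ (∑ (suc N) rec)) (+-monoˡ-≤ (∑ (suc N) rec) 0≤1)

-- Raising the exponent by one keeps linear growth: an increment of the higher power is about 1/N
-- times the lower power, which is linear, so the increments are bounded.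
harm↑≤linear : ∀ d → ∃ λ K → 1ℚ ≤ℚ K × (∀ N → harm N ↑ d ≤ℚ K * ι (suc N))
harm↑≤linear zero = 1ℚ , ≤-refl , λ N → subst (1ℚ ≤ℚ_) (trans (+-comm 1ℚ (ι N))
  (trans (sym (ι-suc N)) (sym (*-identityˡ (ι (suc N)))))) (p≤p+q (ι-nonneg N))
harm↑≤linear (suc d) with harm↑≤linear d
... | K , 1≤K , bound = K′ , 1≤K′ , bound′
  where
  open ≤-Reasoning
  0≤K = ≤-trans 0≤1 1≤K
  -- An increment is at most (d+1) K (N+2)/(N+1), and (N+2)/(N+1) is at most 2.
  K′ = ι (suc d) * (K * (1ℚ + 1ℚ))
  1≤ι : 1ℚ ≤ℚ ι (suc d)
  1≤ι = subst (1ℚ ≤ℚ_) (trans (+-comm 1ℚ (ι d)) (sym (ι-suc d))) (p≤p+q (ι-nonneg d))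
  1≤K′ : 1ℚ ≤ℚ K′
  1≤K′ = *-mono-≤ {1ℚ} {ι (suc d)} {1ℚ} 0≤1 (*-nonneg 0≤K (+-nonneg 0≤1 0≤1)) 1≤ι
    (*-mono-≤ {1ℚ} {K} {1ℚ} {1ℚ + 1ℚ} 0≤1 (+-nonneg 0≤1 0≤1) 1≤K (p≤p+q 0≤1))
  step : ∀ N → ι (suc (suc N)) * rec (suc N) ≤ℚ 1ℚ + 1ℚ
  step N = begin
    ι (suc (suc N)) * rec (suc N)        ≡⟨ cong (_* rec (suc N)) (ι-suc (suc N)) ⟩
    (ι (suc N) + 1ℚ) * rec (suc N)
      ≡⟨ solve 2 (λ i r → (i :+ con 1ℚ) :* r := i :* r :+ r) refl (ι (suc N)) (rec (suc N)) ⟩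
    ι (suc N) * rec (suc N) + rec (suc N) ≤⟨ +-mono-≤ (≤-reflexive (ι-rec N)) (rec≤1 (suc N)) ⟩
    1ℚ + 1ℚ                              ∎
  bound′ : ∀ N → harm N ↑ suc d ≤ℚ K′ * ι (suc N)
  bound′ zero = begin
    1ℚ * 1ℚ ↑ d    ≡⟨ *-identityˡ (1ℚ ↑ d) ⟩
    1ℚ ↑ d         ≤⟨ one d ⟩
    1ℚ             ≤⟨ 1≤K′ ⟩
    K′             ≡⟨ *-identityʳ K′ ⟨
    K′ * ι 1       ∎
    where
    one : ∀ d → 1ℚ ↑ d ≤ℚ 1ℚ
    one zero    = ≤-refl
    one (suc d) = ≤-trans (≤-reflexive (*-identityˡ (1ℚ ↑ d))) (one d)
  bound′ (suc N) = begin
    harm (suc N) ↑ suc d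
      ≡⟨ cong (_↑ suc d) split ⟩
    (harm N + r) ↑ suc d
      ≤⟨ ↑-increment d (harm-nonneg N) (rec-nonneg (suc N)) ⟩
    harm N ↑ suc d + ι (suc d) * (r * (harm N + r) ↑ d)
      ≡⟨ cong (λ t → harm N ↑ suc d + ι (suc d) * (r * t ↑ d)) split ⟨
    harm N ↑ suc d + ι (suc d) * (r * harm (suc N) ↑ d)
      ≤⟨ +-mono-≤ (bound′ N) (*-monoˡ-≤ (ι-nonneg (suc d)) (*-monoˡ-≤ (rec-nonneg (suc N)) (bound (suc N)))) ⟩
    K′ * ι (suc N) + ι (suc d) * (r * (K * ι (suc (suc N))))
      ≡⟨ cong (K′ * ι (suc N) +_) (cong (ι (suc d) *_) (solve 3 (λ r K i → r :* (K :* i) := K :* (i :* r)) refl r K (ι (suc (suc N))))) ⟩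
    K′ * ι (suc N) + ι (suc d) * (K * (ι (suc (suc N)) * r))
      ≤⟨ +-monoʳ-≤ (K′ * ι (suc N)) (*-monoˡ-≤ (ι-nonneg (suc d)) (*-monoˡ-≤ 0≤K (step N))) ⟩
    K′ * ι (suc N) + K′
      ≡⟨ solve 2 (λ k i → k :* i :+ k := k :* (i :+ con 1ℚ)) refl K′ (ι (suc N)) ⟩
    K′ * (ι (suc N) + 1ℚ)
      ≡⟨ cong (K′ *_) (ι-suc (suc N)) ⟨
    K′ * ι (suc (suc N)) ∎
    where
    r = rec (suc N)
    split : harm (suc N) ≡ harm N + r
    split = sym (+-assoc 1ℚ (∑ (suc N) rec) r)

LogBounded : (ℕ → ℚ) → Set
LogBounded g = ∃ λ d → ∀ N → ∣ g N ∣ ≤ℚ harm N ↑ d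

-- The explicit rate lets a factor bounded only by a power of `harm` be absorbed. Since `harm` is at
-- least 1, two rates are merged by adding exponents.
Negligible : (ℕ → ℚ) → Set
Negligible f = ∃ λ K → ∃ λ d → 0ℚ ≤ℚ K × (∀ N → ∣ f N ∣ ≤ℚ K * harm N ↑ d * rec (suc N))

Negligible-resp : ∀ {f g} → (∀ N → f N ≡ g N) → Negligible f → Negligible g
Negligible-resp e (K , d , 0≤K , le) =
  K , d , 0≤K , λ N → subst (λ t → ∣ t ∣ ≤ℚ K * harm N ↑ d * rec (suc N)) (e N) (le N)

Negligible-0 : Negligible (λ _ → 0ℚ)
Negligible-0 = 0ℚ , 0 , ≤-refl , λ N → ≤-reflexive (sym (*-zeroˡ (rec (suc N))))

Negligible-+ : ∀ {f g} → Negligible f → Negligible g → Negligible (λ N → f N + g N)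
Negligible-+ {f} {g} (K , d , 0≤K , f≤) (L , e , 0≤L , g≤) =
  K + L , d ℕ.+ e , +-nonneg 0≤K 0≤L , λ N →
  let h = harm N ; r = rec (suc N) in begin
  ∣ f N + g N ∣                            ≤⟨ ∣p+q∣≤∣p∣+∣q∣ (f N) (g N) ⟩
  ∣ f N ∣ + ∣ g N ∣                        ≤⟨ +-mono-≤ (f≤ N) (g≤ N) ⟩
  K * h ↑ d * r + L * h ↑ e * r            ≤⟨ +-mono-≤
      (*-monoʳ-≤ (rec-nonneg (suc N)) (*-monoˡ-≤ 0≤K (raiseʳ N d e)))
      (*-monoʳ-≤ (rec-nonneg (suc N)) (*-monoˡ-≤ 0≤L (raiseˡ N d e))) ⟩
  K * (h ↑ d * h ↑ e) * r + L * (h ↑ d * h ↑ e) * r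
                                           ≡⟨ solve 4 (λ K L H r → K :* H :* r :+ L :* H :* r := (K :+ L) :* H :* r)
                                                refl K L (h ↑ d * h ↑ e) r ⟩
  (K + L) * (h ↑ d * h ↑ e) * r            ≡⟨ cong (λ t → (K + L) * t * r) (↑-+ h d e) ⟨
  (K + L) * h ↑ (d ℕ.+ e) * r              ∎
  where
  open ≤-Reasoning
  raiseʳ : ∀ N d e → harm N ↑ d ≤ℚ harm N ↑ d * harm N ↑ e
  raiseʳ N d e = subst (_≤ℚ harm N ↑ d * harm N ↑ e) (*-identityʳ (harm N ↑ d))
    (*-monoˡ-≤ (↑-nonneg d (harm-nonneg N)) (1≤↑ e (1≤harm N)))
  raiseˡ : ∀ N d e → harm N ↑ e ≤ℚ harm N ↑ d * harm N ↑ e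
  raiseˡ N d e = subst (_≤ℚ harm N ↑ d * harm N ↑ e) (*-identityˡ (harm N ↑ e))
    (*-monoʳ-≤ (↑-nonneg e (harm-nonneg N)) (1≤↑ d (1≤harm N)))

Negligible-neg : ∀ {f} → Negligible f → Negligible (λ N → - f N)
Negligible-neg {f} (K , d , 0≤K , f≤) =
  K , d , 0≤K , λ N → subst (_≤ℚ K * harm N ↑ d * rec (suc N)) (sym (∣-p∣≡∣p∣ (f N))) (f≤ N)

Negligible-* : ∀ {f g} → LogBounded g → Negligible f → Negligible (λ N → g N * f N)
Negligible-* {f} {g} (e , g≤) (K , d , 0≤K , f≤) = K , e ℕ.+ d , 0≤K , λ N →
  let h = harm N ; r = rec (suc N) in begin
  ∣ g N * f N ∣                    ≡⟨ ∣p*q∣≡∣p∣*∣q∣ (g N) (f N) ⟩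
  ∣ g N ∣ * ∣ f N ∣
    ≤⟨ *-mono-≤ (0≤∣p∣ (g N)) (≤-trans (0≤∣p∣ (f N)) (f≤ N)) (g≤ N) (f≤ N) ⟩
  h ↑ e * (K * h ↑ d * r)
    ≡⟨ solve 4 (λ E K D r → E :* (K :* D :* r) := K :* (E :* D) :* r) refl (h ↑ e) K (h ↑ d) r ⟩
  K * (h ↑ e * h ↑ d) * r          ≡⟨ cong (λ t → K * t * r) (↑-+ h e d) ⟨
  K * h ↑ (e ℕ.+ d) * r            ∎
  where open ≤-Reasoning

Negligible-∑ : ∀ n {f : ℕ → ℕ → ℚ} → (∀ i → i ℕ.< n → Negligible (λ N → f N i)) → Negligible (λ N → ∑ n (f N))
Negligible-∑ zero    neg = Negligible-0
Negligible-∑ (suc n) neg = Negligible-+ (Negligible-∑ n (λ i i<n → neg i (ℕₚ.m<n⇒m<1+n i<n))) (neg n (ℕₚ.n<1+n n))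

ι-mono-≤ : ∀ {a b} → a ≤ b → ι a ≤ℚ ι b
ι-mono-≤ {a} {b} a≤b = subst (ι a ≤ℚ_) (trans (sym (ι-+ a (b ∸ a))) (cong ι (ℕₚ.m+[n∸m]≡n a≤b))) (p≤p+q (ι-nonneg (b ∸ a)))

-- If ε < |f N| then, with |f N| ≤ K (harm N)^d / (N+1) and (harm N)^(2d) ≤ L (N+1),
-- squaring gives ε² (N+1) < K² L, which fails for large N.
Negligible⇒null : ∀ {f} → Negligible f → ∀ ε → 0ℚ < ε → ∃ λ N₀ → ∀ N → N ≥ N₀ → ∣ f N ∣ ≤ℚ ε
Negligible⇒null {f} (K , d , 0≤K , f≤) ε 0<ε with harm↑≤linear (d ℕ.+ d)
... | L , 1≤L , h≤ with archimedean (K * K * L * (1/ (ε * ε)) {{nz}})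
  where nz = pos⇒nonZero (ε * ε) {{pos*pos⇒pos ε {{positive 0<ε}} ε {{positive 0<ε}}}}
... | N₀ , le = N₀ , conclude
  where
  open ≤-Reasoning
  ε²-pos = pos*pos⇒pos ε {{positive 0<ε}} ε {{positive 0<ε}}
  nz = pos⇒nonZero (ε * ε) {{ε²-pos}}
  0≤ε = <⇒≤ 0<ε
  0≤L = ≤-trans 0≤1 1≤L
  large : ∀ N → N ≥ N₀ → K * K * L ≤ℚ ε * ε * ι (suc N)
  large N N≥ = begin
    K * K * L                                 ≡⟨ *-identityʳ (K * K * L) ⟨
    K * K * L * 1ℚ                            ≡⟨ cong (K * K * L *_) (*-inverseˡ (ε * ε) {{nz}}) ⟨
    K * K * L * ((1/ (ε * ε)) {{nz}} * (ε * ε)) ≡⟨ *-assoc (K * K * L) _ (ε * ε) ⟨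
    K * K * L * (1/ (ε * ε)) {{nz}} * (ε * ε)
      ≤⟨ *-monoʳ-≤ (*-nonneg 0≤ε 0≤ε) (≤-trans le (ι-mono-≤ (ℕₚ.m≤n⇒m≤1+n N≥))) ⟩
    ι (suc N) * (ε * ε)                       ≡⟨ *-comm (ι (suc N)) (ε * ε) ⟩
    ε * ε * ι (suc N)                         ∎
  square : ∀ N → ∣ f N ∣ * ∣ f N ∣ ≤ℚ K * K * L * rec (suc N)
  square N = let h = harm N ; r = rec (suc N) ; b = K * h ↑ d * r in begin
    ∣ f N ∣ * ∣ f N ∣
      ≤⟨ *-mono-≤ (0≤∣p∣ (f N)) (≤-trans (0≤∣p∣ (f N)) (f≤ N)) (f≤ N) (f≤ N) ⟩
    b * b
      ≡⟨ solve 3 (λ K H r → (K :* H :* r) :* (K :* H :* r) := (K :* K :* r :* r) :* (H :* H)) refl K (h ↑ d) r ⟩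
    (K * K * r * r) * (h ↑ d * h ↑ d)    ≡⟨ cong ((K * K * r * r) *_) (↑-+ h d d) ⟨
    (K * K * r * r) * h ↑ (d ℕ.+ d)
      ≤⟨ *-monoˡ-≤ (*-nonneg (*-nonneg (*-nonneg 0≤K 0≤K) (rec-nonneg (suc N))) (rec-nonneg (suc N))) (h≤ N) ⟩
    (K * K * r * r) * (L * ι (suc N))
      ≡⟨ solve 4 (λ K L r i → (K :* K :* r :* r) :* (L :* i) := (K :* K :* L :* r) :* (i :* r)) refl K L r (ι (suc N)) ⟩
    (K * K * L * r) * (ι (suc N) * r)    ≡⟨ cong ((K * K * L * r) *_) (ι-rec N) ⟩
    (K * K * L * r) * 1ℚ                 ≡⟨ *-identityʳ _ ⟩
    K * K * L * r                        ∎
  conclude : ∀ N → N ≥ N₀ → ∣ f N ∣ ≤ℚ ε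
  conclude N N≥ with ∣ f N ∣ ≤? ε
  ... | yes p = p
  ... | no ¬p = contradiction (begin-strict
    ε * ε                                ≤⟨ *-monoˡ-≤ 0≤ε (<⇒≤ ε<) ⟩
    ε * ∣ f N ∣                          <⟨ *-monoˡ-<-pos ∣ f N ∣ {{positive (<-trans 0<ε ε<)}} ε< ⟩
    ∣ f N ∣ * ∣ f N ∣                    ≤⟨ square N ⟩
    K * K * L * rec (suc N)              ≤⟨ *-monoʳ-≤ (rec-nonneg (suc N)) (large N N≥) ⟩
    ε * ε * ι (suc N) * rec (suc N)      ≡⟨ *-assoc (ε * ε) (ι (suc N)) (rec (suc N)) ⟩
    ε * ε * (ι (suc N) * rec (suc N))    ≡⟨ cong (ε * ε *_) (ι-rec N) ⟩
    ε * ε * 1ℚ                           ≡⟨ *-identityʳ (ε * ε) ⟩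
    ε * ε                                ∎) (<-irrefl refl)
    where ε< = ≰⇒> ¬p

-- Connected sums and duality

-- Hoffman's alphabet: an entry s is the block x^(s-1) y, and duality reverses a word and exchanges
-- the letters. Words are used because transport moves one letter at a time.
data Letter : Set where
  x y : Letter

Word : Set
Word = List Letter

-- A w n is the part of the multiple harmonic sum of w whose largest summation index
-- equals n; index 0 only occurs for the empty word.
A : Word → ℕ → ℚ
A []      zero    = 1ℚ
A []      (suc n) = 0ℚ
A (x ∷ w) n       = rec n * A w n
A (y ∷ w) n       = rec n * ∑ n (A w)

A-zero : ∀ c w → A (c ∷ w) 0 ≡ 0ℚ
A-zero x w = *-zeroˡ (A w 0)
A-zero y w = refl

A-nonneg : ∀ w n → 0ℚ ≤ℚ A w n
A-nonneg []      zero    = 0≤1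
A-nonneg []      (suc n) = ≤-refl
A-nonneg (x ∷ w) n       = *-nonneg (rec-nonneg n) (A-nonneg w n)
A-nonneg (y ∷ w) n       = *-nonneg (rec-nonneg n) (∑-nonneg n (A-nonneg w))

zetaW : ℕ → Word → ℚ
zetaW N w = ∑ (suc N) (A w)

zetaW-nonneg : ∀ N w → 0ℚ ≤ℚ zetaW N w
zetaW-nonneg N w = ∑-nonneg (suc N) (A-nonneg w)

∑-mono-bound : ∀ {m n f} → (∀ i → 0ℚ ≤ℚ f i) → m ≤ n → ∑ m f ≤ℚ ∑ n f
∑-mono-bound {n = zero}  f≥0 z≤n = ≤-refl
∑-mono-bound {m} {suc n} f≥0 m≤n with ℕₚ.m≤n⇒m<n∨m≡n m≤n
... | inj₁ (s≤s m≤n′) = ≤-trans (∑-mono-bound f≥0 m≤n′) (p≤p+q (f≥0 n))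
... | inj₂ refl       = ≤-refl

zetaW-[] : ∀ N → zetaW N [] ≡ 1ℚ
zetaW-[] N = trans (∑-head N (A [])) (trans (cong (1ℚ +_) (∑-zero N)) (+-identityʳ 1ℚ))

-- A letter `y` costs one factor `harm`. A letter `x` costs nothing, but is charged the same so that
-- the exponent is the length.
zetaW≤harm : ∀ N w → zetaW N w ≤ℚ harm N ↑ length w
zetaW≤harm N []      = ≤-reflexive (zetaW-[] N)
zetaW≤harm N (x ∷ w) = begin
  ∑ (suc N) (λ n → rec n * A w n)
    ≤⟨ ∑-mono-≤ (suc N) (λ n _ → subst (rec n * A w n ≤ℚ_) (*-identityˡ (A w n))
        (*-monoʳ-≤ (A-nonneg w n) (rec≤1 n))) ⟩
  zetaW N w                          ≤⟨ zetaW≤harm N w ⟩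
  harm N ↑ length w                  ≡⟨ *-identityˡ _ ⟨
  1ℚ * harm N ↑ length w             ≤⟨ *-monoʳ-≤ (↑-nonneg (length w) (harm-nonneg N)) (1≤harm N) ⟩
  harm N * harm N ↑ length w         ∎
  where open ≤-Reasoning
zetaW≤harm N (y ∷ w) = begin
  ∑ (suc N) (λ n → rec n * ∑ n (A w))       ≤⟨ ∑-mono-≤ (suc N) (λ n n<sN → *-monoˡ-≤ (rec-nonneg n)
                                                 (∑-mono-bound (A-nonneg w) (ℕₚ.<⇒≤ n<sN))) ⟩
  ∑ (suc N) (λ n → rec n * zetaW N w)       ≡⟨ *-distribʳ-∑ (suc N) (zetaW N w) rec ⟨
  ∑ (suc N) rec * zetaW N w
    ≤⟨ *-mono-≤ (∑-nonneg (suc N) rec-nonneg) (↑-nonneg (length w) (harm-nonneg N))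
        (∑rec≤harm N) (zetaW≤harm N w) ⟩
  harm N * harm N ↑ length w                ∎
  where open ≤-Reasoning

fac rfac : ℕ → ℚ
fac zero     = 1ℚ
fac (suc n)  = ι (suc n) * fac n
rfac zero    = 1ℚ
rfac (suc n) = rec (suc n) * rfac n

-- The Seki–Yamamoto connector n! k! / (n+k)!.
conn : ℕ → ℕ → ℚ
conn n k = fac n * fac k * rfac (n ℕ.+ k)

conn-comm : ∀ n k → conn n k ≡ conn k n
conn-comm n k = cong₂ _*_ (*-comm (fac n) (fac k)) (cong rfac (ℕₚ.+-comm n k))

fac-nonneg : ∀ n → 0ℚ ≤ℚ fac n
fac-nonneg zero    = 0≤1
fac-nonneg (suc n) = *-nonneg (ι-nonneg (suc n)) (fac-nonneg n)

rfac-nonneg : ∀ n → 0ℚ ≤ℚ rfac n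
rfac-nonneg zero    = 0≤1
rfac-nonneg (suc n) = *-nonneg (rec-nonneg (suc n)) (rfac-nonneg n)

conn-nonneg : ∀ n k → 0ℚ ≤ℚ conn n k
conn-nonneg n k = *-nonneg (*-nonneg (fac-nonneg n) (fac-nonneg k)) (rfac-nonneg (n ℕ.+ k))

fac*rfac : ∀ n → fac n * rfac n ≡ 1ℚ
fac*rfac zero    = refl
fac*rfac (suc n) = trans
  (solve 4 (λ i f r g → (i :* f) :* (r :* g) := (i :* r) :* (f :* g)) refl (ι (suc n)) (fac n) (rec (suc n)) (rfac n))
  (cong₂ _*_ (ι-rec n) (fac*rfac n))

conn-0ʳ : ∀ n → conn n 0 ≡ 1ℚ
conn-0ʳ n = trans (cong₂ _*_ (*-identityʳ (fac n)) (cong rfac (ℕₚ.+-identityʳ n))) (fac*rfac n)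

rfac-unfold : ∀ n → ι (suc n) * rfac (suc n) ≡ rfac n
rfac-unfold n = trans (sym (*-assoc (ι (suc n)) (rec (suc n)) (rfac n)))
  (trans (cong (_* rfac n) (ι-rec n)) (*-identityˡ (rfac n)))

-- Over the common denominator (n+1+k)! the numerators differ by the factor (n+1+k) - (n+1) = k.
conn-step : ∀ n k → conn n k - conn (suc n) k ≡ ι k * (fac n * fac k * rfac (suc n ℕ.+ k))
conn-step n k = begin
  F * G * rfac (n ℕ.+ k) - (i * F) * G * R       ≡⟨ cong (λ t → F * G * t - (i * F) * G * R)
                                                          (sym (rfac-unfold (n ℕ.+ k))) ⟩
  F * G * (ι (suc n ℕ.+ k) * R) - (i * F) * G * R
    ≡⟨ cong (λ t → F * G * (t * R) - (i * F) * G * R) (ι-+ (suc n) k) ⟩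
  F * G * ((i + j) * R) - (i * F) * G * R
    ≡⟨ solve 5 (λ F G i j R → F :* G :* ((i :+ j) :* R) :- (i :* F) :* G :* R
        := j :* (F :* G :* R)) refl F G i j R ⟩
  j * (F * G * R)                                    ∎
  where
  open ≡-Reasoning
  F = fac n
  G = fac k
  R = rfac (suc n ℕ.+ k)
  i = ι (suc n)
  j = ι k

-- Both sides equal n! (k+1)! / (n+k+2)!. This trades a factor 1/n on one side of the connector for
-- 1/k on the other, and the difference telescopes in n.
conn-telescope : ∀ n k → rec (suc n) * conn (suc n) (suc k) ≡ rec (suc k) * (conn n (suc k) - conn (suc n) (suc k))
conn-telescope n k = begin
  r * (i * F * G * R)
    ≡⟨ solve 5 (λ r i F G R → r :* (i :* F :* G :* R) := (i :* r) :* (F :* G :* R)) refl r i F G R ⟩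
  (i * r) * (F * G * R)        ≡⟨ cong (_* (F * G * R)) (trans (ι-rec n) (sym (ι-rec k))) ⟩
  (j * s) * (F * G * R)
    ≡⟨ solve 3 (λ j s t → (j :* s) :* t := s :* (j :* t)) refl j s (F * G * R) ⟩
  s * (j * (F * G * R))        ≡⟨ cong (s *_) (conn-step n (suc k)) ⟨
  s * (conn n (suc k) - conn (suc n) (suc k)) ∎
  where
  open ≡-Reasoning
  F = fac n
  G = fac (suc k)
  R = rfac (suc n ℕ.+ suc k)
  i = ι (suc n)
  j = ι (suc k)
  r = rec (suc n)
  s = rec (suc k)

p-q≥0⇒q≤p : ∀ {p q} → 0ℚ ≤ℚ p - q → q ≤ℚ p
p-q≥0⇒q≤p {p} {q} le = subst (q ≤ℚ_) (solve 2 (λ p q → q :+ (p :- q) := p) refl p q) (p≤p+q le)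

-- The connector is 1/(N+1) at (N, 1) and decreases in its second argument. This is the source of
-- the 1/N in the transport errors.
conn≤rec : ∀ N k → conn N (suc k) ≤ℚ rec (suc N)
conn≤rec N zero    = ≤-reflexive (trans
  (cong (fac N * 1ℚ *_) (cong rfac (ℕₚ.+-comm N 1)))
  (trans (solve 3 (λ f r g → f :* con 1ℚ :* (r :* g) := r :* (f :* g)) refl (fac N) (rec (suc N)) (rfac N))
  (trans (cong (rec (suc N) *_) (fac*rfac N)) (*-identityʳ (rec (suc N))))))
conn≤rec N (suc k) = ≤-trans antitone (conn≤rec N k)
  where
  antitone : conn N (suc (suc k)) ≤ℚ conn N (suc k)
  antitone = p-q≥0⇒q≤p (subst (0ℚ ≤ℚ_)
    (trans (sym (conn-step (suc k) N)) (cong₂ _-_ (conn-comm (suc k) N) (conn-comm (suc (suc k)) N)))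
    (*-nonneg (ι-nonneg N) (*-nonneg (*-nonneg (fac-nonneg (suc k)) (fac-nonneg N)) (rfac-nonneg (suc (suc k) ℕ.+ N)))))

-- For each top index j of `w`, the sum over j < n ≤ N collapses to the connector at j minus the
-- connector at N. The part at N would vanish for infinite sums; the truncation keeps it.
∑-conn-telescope : ∀ N w k →
  ∑ (suc N) (λ n → A (y ∷ w) n * conn n (suc k))
    ≡ rec (suc k) * (∑ (suc N) (λ n → A w n * conn n (suc k)) - zetaW N w * conn N (suc k))
∑-conn-telescope zero w k = solve 3
  (λ a b r → con 0ℚ :+ con 0ℚ :* con 0ℚ :* b := r :* ((con 0ℚ :+ a :* b) :- (con 0ℚ :+ a) :* b))
  refl (A w 0) (conn 0 (suc k)) (rec (suc k))
∑-conn-telescope (suc N) w k = begin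
  L + r * S * c′                        ≡⟨ cong₂ _+_ (∑-conn-telescope N w k)
                                             (solve 3 (λ r S c → r :* S :* c := S :* (r :* c)) refl r S c′) ⟩
  s * (T - S * c) + S * (r * c′)        ≡⟨ cong (λ t → s * (T - S * c) + S * t) (conn-telescope N k) ⟩
  s * (T - S * c) + S * (s * (c - c′))
    ≡⟨ solve 6 (λ s T S c c′ a → s :* (T :- S :* c) :+ S :* (s :* (c :- c′))
        := s :* ((T :+ a :* c′) :- (S :+ a) :* c′)) refl s T S c c′ (A w (suc N)) ⟩
  s * ((T + A w (suc N) * c′) - (S + A w (suc N)) * c′) ∎
  where
  open ≡-Reasoning
  L = ∑ (suc N) (λ n → A (y ∷ w) n * conn n (suc k))
  T = ∑ (suc N) (λ n → A w n * conn n (suc k))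
  S = zetaW N w
  r = rec (suc N)
  s = rec (suc k)
  c = conn N (suc k)
  c′ = conn (suc N) (suc k)

-- The connected sum cut off to the square n, k ≤ N, where n and k are the largest summation indices
-- of the two words.
Z : ℕ → Word → Word → ℚ
Z N w v = ∑ (suc N) (λ k → A v k * ∑ (suc N) (λ n → A w n * conn n k))

Z-comm : ∀ N w v → Z N w v ≡ Z N v w
Z-comm N w v = begin
  ∑ M (λ k → A v k * ∑ M (λ n → A w n * conn n k))
    ≡⟨ ∑-cong M (λ k → *-distribˡ-∑ M (A v k) (λ n → A w n * conn n k)) ⟩
  ∑ M (λ k → ∑ M (λ n → A v k * (A w n * conn n k)))
    ≡⟨ ∑-comm M M (λ k n → A v k * (A w n * conn n k)) ⟩
  ∑ M (λ n → ∑ M (λ k → A v k * (A w n * conn n k)))   ≡⟨ ∑-cong M (λ n → ∑-cong M (λ k → trans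
       (cong (λ t → A v k * (A w n * t)) (conn-comm n k))
       (solve 3 (λ a b c → a :* (b :* c) := b :* (a :* c)) refl (A v k) (A w n) (conn k n)))) ⟩
  ∑ M (λ n → ∑ M (λ k → A w n * (A v k * conn k n)))
    ≡⟨ ∑-cong M (λ n → *-distribˡ-∑ M (A w n) (λ k → A v k * conn k n)) ⟨
  ∑ M (λ n → A w n * ∑ M (λ k → A v k * conn k n))     ∎
  where
  open ≡-Reasoning
  M = suc N

-- The empty word has all its weight at k = 0, where the connector is 1.
Z-[] : ∀ N w → Z N w [] ≡ zetaW N w
Z-[] N w = begin
  ∑ (suc N) (λ k → A [] k * G k)        ≡⟨ ∑-head N (λ k → A [] k * G k) ⟩
  1ℚ * G 0 + ∑ N (λ k → 0ℚ * G (suc k)) ≡⟨ cong₂ _+_ (*-identityˡ (G 0))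
                                             (trans (∑-cong N (λ k → *-zeroˡ (G (suc k)))) (∑-zero N)) ⟩
  G 0 + 0ℚ                              ≡⟨ +-identityʳ (G 0) ⟩
  G 0
    ≡⟨ ∑-cong (suc N) (λ n → trans (cong (A w n *_) (conn-0ʳ n)) (*-identityʳ (A w n))) ⟩
  zetaW N w                             ∎
  where
  open ≡-Reasoning
  G : ℕ → ℚ
  G k = ∑ (suc N) (λ n → A w n * conn n k)

-- The boundary part at n = N of `∑-conn-telescope`, summed over k.
transportError : ℕ → Word → Word → ℚ
transportError N w v = zetaW N w * ∑ (suc N) (λ k → A v k * conn N k)

-- The telescoping trades 1/n for 1/k, so it needs k > 0. The letter `c` ensures this: a nonempty
-- word has no weight at 0.
Z-transport : ∀ N w c v →
  Z N w (x ∷ c ∷ v) - Z N (y ∷ w) (c ∷ v) ≡ transportError N w (x ∷ c ∷ v)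
Z-transport N w c v = begin
  Z N w (x ∷ c ∷ v) - Z N (y ∷ w) (c ∷ v)
    ≡⟨ cong (λ t → Z N w (x ∷ c ∷ v) - t) (∑-cong (suc N) step) ⟩
  Z N w (x ∷ c ∷ v) - ∑ (suc N) (λ k → B k * (G k - W * conn N k))
    ≡⟨ ∑-distrib-- (suc N) (λ k → B k * G k) (λ k → B k * (G k - W * conn N k)) ⟨
  ∑ (suc N) (λ k → B k * G k - B k * (G k - W * conn N k))
    ≡⟨ ∑-cong (suc N) (λ k → solve 4 (λ b g w c → b :* g :- b :* (g :- w :* c) := w :* (b :* c)) refl (B k) (G k) W (conn N k)) ⟩
  ∑ (suc N) (λ k → W * (B k * conn N k))
    ≡⟨ *-distribˡ-∑ (suc N) W (λ k → B k * conn N k) ⟨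
  W * ∑ (suc N) (λ k → B k * conn N k) ∎
  where
  open ≡-Reasoning
  W = zetaW N w
  B = A (x ∷ c ∷ v)
  G : ℕ → ℚ
  G k = ∑ (suc N) (λ n → A w n * conn n k)
  step : ∀ k → A (c ∷ v) k * ∑ (suc N) (λ n → A (y ∷ w) n * conn n k) ≡ B k * (G k - W * conn N k)
  step zero    = trans
    (trans (cong (_* G′) (A-zero c v)) (*-zeroˡ G′))
    (sym (trans (cong (_* (G 0 - W * conn N 0)) (A-zero x (c ∷ v))) (*-zeroˡ (G 0 - W * conn N 0))))
    where G′ = ∑ (suc N) (λ n → A (y ∷ w) n * conn n 0)
  step (suc k) = trans (cong (A (c ∷ v) (suc k) *_) (∑-conn-telescope N w k))
    (solve 3 (λ a r t → a :* (r :* t) := (r :* a) :* t) refl (A (c ∷ v) (suc k)) (rec (suc k)) (G (suc k) - W * conn N (suc k)))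

-- Only k > 0 carries weight, so the connector gives 1/(N+1); the two truncated sums give a power of
-- `harm`.
transportError-negligible : ∀ w c v → Negligible (λ N → transportError N w (c ∷ v))
transportError-negligible w c v = 1ℚ , length w ℕ.+ length (c ∷ v) , 0≤1 , λ N →
  let h = harm N ; r = rec (suc N) ; S = ∑ (suc N) (λ k → A (c ∷ v) k * conn N k)
      S≥0 = ∑-nonneg (suc N) (λ k → *-nonneg (A-nonneg (c ∷ v) k) (conn-nonneg N k)) in begin
  ∣ zetaW N w * S ∣                          ≡⟨ 0≤p⇒∣p∣≡p (*-nonneg (zetaW-nonneg N w) S≥0) ⟩
  zetaW N w * S
    ≤⟨ *-monoˡ-≤ (zetaW-nonneg N w) (∑-mono-≤ (suc N) (λ k _ → term N k)) ⟩
  zetaW N w * ∑ (suc N) (λ k → A (c ∷ v) k * r)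
                                             ≡⟨ cong (zetaW N w *_) (*-distribʳ-∑ (suc N) r (A (c ∷ v))) ⟨
  zetaW N w * (zetaW N (c ∷ v) * r)          ≤⟨ *-mono-≤ (zetaW-nonneg N w)
                                                  (*-nonneg (↑-nonneg (length (c ∷ v)) (harm-nonneg N)) (rec-nonneg (suc N)))
                                                  (zetaW≤harm N w) (*-monoʳ-≤ (rec-nonneg (suc N)) (zetaW≤harm N (c ∷ v))) ⟩
  h ↑ length w * (h ↑ length (c ∷ v) * r)
    ≡⟨ solve 3 (λ a b r → a :* (b :* r) := con 1ℚ :* (a :* b) :* r) refl (h ↑ length w) (h ↑ length (c ∷ v)) r ⟩
  1ℚ * (h ↑ length w * h ↑ length (c ∷ v)) * r
    ≡⟨ cong (λ t → 1ℚ * t * r) (↑-+ h (length w) (length (c ∷ v))) ⟨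
  1ℚ * h ↑ (length w ℕ.+ length (c ∷ v)) * r ∎
  where
  open ≤-Reasoning
  term : ∀ N k → A (c ∷ v) k * conn N k ≤ℚ A (c ∷ v) k * rec (suc N)
  term N zero    = ≤-reflexive (trans (cong (_* conn N 0) (A-zero c v)) (trans (*-zeroˡ (conn N 0))
    (sym (trans (cong (_* rec (suc N)) (A-zero c v)) (*-zeroˡ (rec (suc N)))))))
  term N (suc k) = *-monoˡ-≤ (A-nonneg (c ∷ v) (suc k)) (conn≤rec N k)

-- Ensures that an `x` leaving the left word never leaves it empty, as `x-transport` demands.
data EndsInY : Word → Set where
  [y] : EndsInY (y ∷ [])
  _∷_ : ∀ c {w} → EndsInY w → EndsInY (c ∷ w)

dualOnto : Word → Word → Word
dualOnto []      v = v
dualOnto (x ∷ w) v = dualOnto w (y ∷ v)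
dualOnto (y ∷ w) v = dualOnto w (x ∷ v)

infix 4 _≈_
-- A record, so that both sequences can be inferred from a proof; from the pointwise difference
-- alone they could not.
record _≈_ (f g : ℕ → ℚ) : Set where
  constructor ≈-intro
  field negligible-difference : Negligible (λ N → f N - g N)
open _≈_

≈-trans : ∀ {f g h} → f ≈ g → g ≈ h → f ≈ h
≈-trans {f} {g} {h} (≈-intro fg) (≈-intro gh) = ≈-intro (Negligible-resp
  (λ N → solve 3 (λ f g h → (f :- g) :+ (g :- h) := f :- h) refl (f N) (g N) (h N)) (Negligible-+ fg gh))

≈-sym : ∀ {f g} → f ≈ g → g ≈ f
≈-sym {f} {g} (≈-intro fg) = ≈-intro (Negligible-resp
  (λ N → solve 2 (λ f g → :- (f :- g) := g :- f) refl (f N) (g N)) (Negligible-neg fg))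

≈-resp : ∀ {f f′ g g′} → (∀ N → f N ≡ f′ N) → (∀ N → g N ≡ g′ N) → f ≈ g → f′ ≈ g′
≈-resp p q (≈-intro fg) = ≈-intro (Negligible-resp (λ N → cong₂ _-_ (p N) (q N)) fg)

y-transport : ∀ w c v → (λ N → Z N (y ∷ w) (c ∷ v)) ≈ (λ N → Z N w (x ∷ c ∷ v))
y-transport w c v = ≈-sym (≈-intro
  (Negligible-resp (λ N → sym (Z-transport N w c v)) (transportError-negligible w x (c ∷ v))))

-- The connector is symmetric, so this is `y-transport` read backwards with the two words exchanged.
x-transport : ∀ d w v → (λ N → Z N (x ∷ d ∷ w) v) ≈ (λ N → Z N (d ∷ w) (y ∷ v))
x-transport d w v = ≈-resp (λ N → Z-comm N v (x ∷ d ∷ w)) (λ N → Z-comm N (y ∷ v) (d ∷ w))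
  (≈-sym (y-transport v d w))

-- Each transport puts the exchanged letter at the front of the right word, as the accumulator of
-- `dualOnto` does. The clauses for `x` differ only in exposing the next letter.
Z-dual : ∀ {w} → EndsInY w → ∀ c v → (λ N → Z N w (c ∷ v)) ≈ (λ N → Z N [] (dualOnto w (c ∷ v)))
Z-dual [y]              c v = y-transport [] c v
Z-dual {_ ∷ w} (y ∷ ends)       c v = ≈-trans (y-transport w c v) (Z-dual ends x (c ∷ v))
Z-dual (x ∷ [y])        c v = ≈-trans (x-transport y [] (c ∷ v)) (Z-dual [y] y (c ∷ v))
Z-dual (x ∷ (d ∷ ends)) c v = ≈-trans (x-transport d _ (c ∷ v)) (Z-dual (d ∷ ends) y (c ∷ v))

-- The right word is empty at the start, and only an `x` can move onto an empty word; this is where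
-- admissibility enters.
duality : ∀ {w} → EndsInY w → (λ N → zetaW N (x ∷ w)) ≈ (λ N → zetaW N (dualOnto (x ∷ w) []))
duality {w} ends = ≈-resp (λ N → Z-[] N (x ∷ w))
  (λ N → trans (Z-comm N [] (dualOnto w (y ∷ []))) (Z-[] N (dualOnto w (y ∷ []))))
  (≈-trans (first ends) (Z-dual ends y []))
  where
  first : ∀ {w} → EndsInY w → (λ N → Z N (x ∷ w) []) ≈ (λ N → Z N w (y ∷ []))
  first [y]        = x-transport y [] []
  first (d ∷ ends) = x-transport d _ []

-- The expansion at finite N

-- The index version of A: the part of ζ_N(ss) with n₁ = n.
B : List ℕ → ℕ → ℚ
B []       n = A [] n
B (s ∷ ss) n = ip n s * ∑ n (B ss)

∑-B : ∀ N ss → ∑ (suc N) (B ss) ≡ zetaN N ss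
∑-B N []       = zetaW-[] N
∑-B N (s ∷ ss) = trans (∑-head N (B (s ∷ ss))) (trans
  (+-identityˡ (∑ N (λ i → B (s ∷ ss) (suc i)))) (trans
  (∑-cong N (λ i → cong (invPow i s *_) (∑-B i ss)))
  (sym (sumFromTo-∑ N 1 N (λ n → invPow (n ∸ 1) s * zetaN (n ∸ 1) ss) refl))))

zetaStarN-∑ : ∀ N s l → zetaStarN N (s ∷ l) ≡ ∑ (suc N) (λ n → ip n s * zetaStarN n l)
zetaStarN-∑ N s l = trans (sumFromTo-∑ N 1 N (λ n → invPow (n ∸ 1) s * zetaStarN n l) refl)
  (sym (trans (∑-head N (λ n → ip n s * zetaStarN n l)) (trans
    (cong (_+ ∑ N (λ i → invPow i s * zetaStarN (suc i) l)) (*-zeroˡ (zetaStarN 0 l)))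
    (+-identityˡ (∑ N (λ i → invPow i s * zetaStarN (suc i) l))))))

-- The truncated Kaneko-Yamamoto value when `ss` is (k_r+1, ..., k_1+1); other `ss` arise as star
-- entries are moved over.
L : ℕ → List ℕ → List ℕ → ℚ
L N ss l = ∑ (suc N) (λ n → B ss n * zetaStarN n l)

-- The condition n₁ ≤ n is dropped and the terms with n₁ > n are subtracted.
L-peel : ∀ N ss s l → L N ss (s ∷ l) ≡ zetaN N ss * zetaStarN N (s ∷ l) - L N (s ∷ ss) l
L-peel N ss s l = begin
  P                     ≡⟨ solve 2 (λ p q → p := (p :+ q) :- q) refl P Q ⟩
  (P + Q) - Q           ≡⟨ cong (_- Q) (cong₂ _+_
                             (∑-cong (suc N) (λ n → cong (B ss n *_) (zetaStarN-∑ n s l)))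
                             (∑-cong (suc N) (λ n → solve 3 (λ a b c → a :* b :* c := a :* c :* b) refl
                               (ip n s) (∑ n (B ss)) (zetaStarN n l)))) ⟩
  (∑ (suc N) (λ n → B ss n * ∑ (suc n) g) + ∑ (suc N) (λ n → g n * ∑ n (B ss))) - Q
                        ≡⟨ cong (_- Q) (∑-by-parts (suc N) (B ss) g) ⟩
  ∑ (suc N) (B ss) * ∑ (suc N) g - Q
                        ≡⟨ cong (_- Q) (cong₂ _*_ (∑-B N ss) (sym (zetaStarN-∑ N s l))) ⟩
  zetaN N ss * zetaStarN N (s ∷ l) - Q ∎
  where
  open ≡-Reasoning
  g : ℕ → ℚ
  g n = ip n s * zetaStarN n l
  P = L N ss (s ∷ l)
  Q = L N (s ∷ ss) l

L-[] : ∀ N ss → L N ss [] ≡ zetaN N ss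
L-[] N ss = trans (∑-cong (suc N) (λ n → *-identityʳ (B ss n))) (∑-B N ss)

-- The empty index lives at n = 0, where a star sum of nonempty index has no terms.
L-vanish : ∀ N s l → L N [] (s ∷ l) ≡ 0ℚ
L-vanish N s l = trans (∑-head N (λ n → B [] n * zetaStarN n (s ∷ l)))
  (trans (+-identityˡ _) (trans (∑-cong N (λ i → *-zeroˡ (zetaStarN (suc i) (s ∷ l)))) (∑-zero N)))

-- Iterates `L-peel`: the head of the star index goes to the front of the strict one with a sign, so
-- the moved entries appear in reverse order.
L-expand : ∀ N a d j ss → L N ss (map a (interval j d)) ≡
  ∑ (suc d) (λ i → sign i * (zetaN N (reverse (map a (interval j i)) ++ ss)
                              * zetaStarN N (map a (interval (j ℕ.+ i) (d ∸ i)))))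
L-expand N a zero j ss = trans (L-[] N ss)
  (solve 1 (λ z → z := con 0ℚ :+ con 1ℚ :* (z :* con 1ℚ)) refl (zetaN N ss))
L-expand N a (suc d) j ss = begin
  L N ss (a j ∷ map a (interval (suc j) d))
    ≡⟨ L-peel N ss (a j) (map a (interval (suc j) d)) ⟩
  z - L N (a j ∷ ss) (map a (interval (suc j) d))
    ≡⟨ cong (λ t → z - t) (L-expand N a d (suc j) (a j ∷ ss)) ⟩
  z - ∑ (suc d) (λ i → sign i * (zetaN N (reverse (map a (interval (suc j) i)) ++ a j ∷ ss)
                                  * zetaStarN N (map a (interval (suc j ℕ.+ i) (d ∸ i)))))
    ≡⟨ cong₂ _+_ head (trans (neg-distrib-∑ (suc d) _) (∑-cong (suc d) tail)) ⟩
  term 0 + ∑ (suc d) (λ i → term (suc i))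
    ≡⟨ ∑-head (suc d) term ⟨
  ∑ (suc (suc d)) term ∎
  where
  open ≡-Reasoning
  z = zetaN N ss * zetaStarN N (map a (interval j (suc d)))
  term : ℕ → ℚ
  term i = sign i * (zetaN N (reverse (map a (interval j i)) ++ ss)
                      * zetaStarN N (map a (interval (j ℕ.+ i) (suc d ∸ i))))
  head : z ≡ term 0
  head = trans (sym (*-identityˡ z)) (cong (λ t → 1ℚ * (zetaN N ss * zetaStarN N (map a (interval t (suc d)))))
    (sym (ℕₚ.+-identityʳ j)))
  tail : ∀ i → - (sign i * (zetaN N (reverse (map a (interval (suc j) i)) ++ a j ∷ ss)
                             * zetaStarN N (map a (interval (suc j ℕ.+ i) (d ∸ i))))) ≡ term (suc i)
  tail i = trans (neg-distribˡ-* (sign i) _) (cong (- sign i *_) (cong₂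
    (λ u v → zetaN N u * zetaStarN N (map a (interval v (d ∸ i))))
    (sym (trans (cong (_++ ss) (Listₚ.unfold-reverse (a j) (map a (interval (suc j) i))))
                (Listₚ.++-assoc (reverse (map a (interval (suc j) i))) (a j ∷ []) ss)))
    (sym (ℕₚ.+-suc j i))))

-- The antipode relation of the quasi-shuffle algebra: for an empty strict index the expansion sums
-- to 0, and it is solved here for its term i = 0.
antipode : ∀ N a d j → zetaStarN N (map a (interval j (suc d))) ≡
  ∑ (suc d) (λ e → sign e * (zetaN N (reverse (map a (interval j (suc e))))
                              * zetaStarN N (map a (interval (j ℕ.+ suc e) (d ∸ e)))))
antipode N a d j = begin
  z                        ≡⟨ solve 2 (λ z t → z := (con 1ℚ :* (con 1ℚ :* z) :+ t) :- t) refl z T ⟩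
  (1ℚ * (1ℚ * z) + T) - T
    ≡⟨ cong (_- T) (cong (λ u → 1ℚ * (1ℚ * zetaStarN N (map a (interval u (suc d)))) + T) (sym (ℕₚ.+-identityʳ j))) ⟩
  (term 0 + T) - T
    ≡⟨ cong (_- T) (trans (sym (∑-head (suc d) term)) (trans (sym (L-expand N a (suc d) j []))
        (L-vanish N (a j) (map a (interval (suc j) d))))) ⟩
  0ℚ - T                   ≡⟨ +-identityˡ (- T) ⟩
  - T                      ≡⟨ trans (neg-distrib-∑ (suc d) (λ e → term (suc e))) (∑-cong (suc d) flip) ⟩
  ∑ (suc d) (λ e → sign e * (zetaN N (reverse (map a (interval j (suc e))))
                              * zetaStarN N (map a (interval (j ℕ.+ suc e) (d ∸ e))))) ∎
  where
  open ≡-Reasoning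
  term : ℕ → ℚ
  term i = sign i * (zetaN N (reverse (map a (interval j i)) ++ [])
                      * zetaStarN N (map a (interval (j ℕ.+ i) (suc d ∸ i))))
  z = zetaStarN N (map a (interval j (suc d)))
  T = ∑ (suc d) (λ e → term (suc e))
  flip : ∀ e → - term (suc e) ≡ sign e * (zetaN N (reverse (map a (interval j (suc e))))
                                  * zetaStarN N (map a (interval (j ℕ.+ suc e) (d ∸ e))))
  flip e = trans (solve 2 (λ s t → :- (:- s :* t) := s :* t) refl (sign e) _)
    (cong (λ u → sign e * (zetaN N u * zetaStarN N (map a (interval (j ℕ.+ suc e) (d ∸ e)))))
      (Listₚ.++-identityʳ (reverse (map a (interval j (suc e))))))

-- Signs and sums over chains

sign-+ : ∀ a b → sign (a ℕ.+ b) ≡ sign a * sign b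
sign-+ zero    b = sym (*-identityˡ (sign b))
sign-+ (suc a) b = trans (cong -_ (sign-+ a b)) (neg-distribˡ-* (sign a) (sign b))

sign*sign : ∀ a → sign a * sign a ≡ 1ℚ
sign*sign zero    = refl
sign*sign (suc a) = trans (solve 1 (λ s → :- s :* :- s := s :* s) refl (sign a)) (sign*sign a)

sign-∸ : ∀ {d e} → e ≤ d → sign d * sign e ≡ sign (d ∸ e)
sign-∸ {d} {e} e≤d = begin
  sign d * sign e                      ≡⟨ cong (λ t → sign t * sign e) (ℕₚ.m∸n+n≡m e≤d) ⟨
  sign (d ∸ e ℕ.+ e) * sign e          ≡⟨ cong (_* sign e) (sign-+ (d ∸ e) e) ⟩
  sign (d ∸ e) * sign e * sign e       ≡⟨ *-assoc (sign (d ∸ e)) (sign e) (sign e) ⟩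
  sign (d ∸ e) * (sign e * sign e)     ≡⟨ cong (sign (d ∸ e) *_) (sign*sign e) ⟩
  sign (d ∸ e) * 1ℚ                    ≡⟨ *-identityʳ (sign (d ∸ e)) ⟩
  sign (d ∸ e)                         ∎
  where open ≡-Reasoning

sumList-++ : ∀ us vs → sumList (us ++ vs) ≡ sumList us + sumList vs
sumList-++ []       vs = sym (+-identityˡ (sumList vs))
sumList-++ (u ∷ us) vs = trans (cong (u +_) (sumList-++ us vs)) (sym (+-assoc u (sumList us) (sumList vs)))

sumList-interval : ∀ (f : ℕ → ℚ) c j → sumList (map f (interval j c)) ≡ ∑ c (λ e → f (j ℕ.+ e))
sumList-interval f zero    j = refl
sumList-interval f (suc c) j = trans
  (cong₂ _+_ (cong f (sym (ℕₚ.+-identityʳ j)))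
    (trans (sumList-interval f c (suc j)) (∑-cong c (λ e → cong f (sym (ℕₚ.+-suc j e))))))
  (sym (∑-head c (λ e → f (j ℕ.+ e))))

sumList-map-* : ∀ {X : Set} c (f : X → ℚ) us → sumList (map (λ u → c * f u) us) ≡ c * sumList (map f us)
sumList-map-* c f []       = sym (*-zeroʳ c)
sumList-map-* c f (u ∷ us) = trans (cong (c * f u +_) (sumList-map-* c f us)) (sym (*-distribˡ-+ c (f u) (sumList (map f us))))

sumList-concatMap : ∀ {X : Set} (f : X → ℚ) (g : ℕ → List X) is →
  sumList (map f (concatMap g is)) ≡ sumList (map (λ i → sumList (map f (g i))) is)
sumList-concatMap f g []       = refl
sumList-concatMap f g (i ∷ is) = trans (cong sumList (Listₚ.map-++ f (g i) (concatMap g is)))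
  (trans (sumList-++ (map f (g i)) (map f (concatMap g is))) (cong (sumList (map f (g i)) +_) (sumList-concatMap f g is)))

≡ᵇ-refl : ∀ i → (i ≡ᵇ i) ≡ true
≡ᵇ-refl zero    = refl
≡ᵇ-refl (suc i) = ≡ᵇ-refl i

≡ᵇ-+suc : ∀ i d → (i ≡ᵇ i ℕ.+ suc d) ≡ false
≡ᵇ-+suc zero    d = refl
≡ᵇ-+suc (suc i) d = ≡ᵇ-+suc i d

primal : (ℕ → ℕ) → List ℕ → ℕ → ℕ → List ℕ
primal m ks kr i = reverse (map (λ t → suc (m t)) (interval 1 i)) ++ suc kr ∷ reverse (map suc ks)

module Truncated (N k : ℕ) (m : ℕ → ℕ) where

  a : ℕ → ℕ
  a t = suc (m t)

  K : ℕ
  K = suc k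

  S : ℕ → ℕ → ℚ
  S i l = sumList (map (chainProdN N m i) (chains i K l))

  S-top : ∀ i → i ≡ K → S i 0 ≡ 1ℚ
  S-top i refl rewrite ≡ᵇ-refl k = refl

  S-below : ∀ i d → i ℕ.+ suc d ≡ K → S i 0 ≡ 0ℚ
  S-below i d e rewrite sym e | ≡ᵇ-+suc i d = refl

  mBlock-interval : ∀ i e → mBlock m i (suc i ℕ.+ e) ≡ reverse (map a (interval i (suc e)))
  mBlock-interval i e = cong (λ l → reverse (map a l))
    (range-interval (suc e) i (i ℕ.+ e) (trans (cong (_∸ i) (sym (ℕₚ.+-suc i e))) (ℕₚ.m+n∸m≡n i (suc e))))

  -- Chains are sorted by their first step i₁ = i+1+e, whose block consists of the e+1 entries from
  -- m_i to m_(i+e), shifted by one.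
  S-suc : ∀ d i l → i ℕ.+ d ≡ K →
    S i (suc l) ≡ ∑ d (λ e → zetaN N (reverse (map a (interval i (suc e)))) * S (suc i ℕ.+ e) l)
  S-suc d i l e≡ = begin
    sumList (map (chainProdN N m i) (concatMap G (range (suc i) K)))
      ≡⟨ cong (λ r → sumList (map (chainProdN N m i) (concatMap G r)))
           (range-interval d (suc i) K (trans (cong (_∸ i) (sym e≡)) (ℕₚ.m+n∸m≡n i d))) ⟩
    sumList (map (chainProdN N m i) (concatMap G (interval (suc i) d)))
      ≡⟨ sumList-concatMap (chainProdN N m i) G (interval (suc i) d) ⟩
    sumList (map (λ i′ → sumList (map (chainProdN N m i) (G i′))) (interval (suc i) d))
      ≡⟨ sumList-interval (λ i′ → sumList (map (chainProdN N m i) (G i′))) d (suc i) ⟩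
    ∑ d (λ e → sumList (map (chainProdN N m i) (G (suc i ℕ.+ e))))
      ≡⟨ ∑-cong d (λ e → trans (cong sumList (sym (Listₚ.map-∘ (chains (suc i ℕ.+ e) K l))))
           (trans (sumList-map-* (zetaN N (mBlock m i (suc i ℕ.+ e))) (chainProdN N m (suc i ℕ.+ e)) (chains (suc i ℕ.+ e) K l))
             (cong (λ t → zetaN N t * S (suc i ℕ.+ e) l) (mBlock-interval i e)))) ⟩
    ∑ d (λ e → zetaN N (reverse (map a (interval i (suc e)))) * S (suc i ℕ.+ e) l) ∎
    where
    open ≡-Reasoning
    G : ℕ → List (List ℕ)
    G i′ = map (i′ ∷_) (chains i′ K l)

  -- Unlike `innerN` this includes l = 0, which starts the recursion. The bound `M` on the number of
  -- steps serves as fuel.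
  T : ℕ → ℕ → ℚ
  T M i = ∑ (suc M) (λ l → sign l * S i l)

  T-suc : ∀ M d i → i ℕ.+ d ≡ K →
    T (suc M) i ≡ S i 0 - ∑ d (λ e → zetaN N (reverse (map a (interval i (suc e)))) * T M (suc i ℕ.+ e))
  T-suc M d i e≡ = begin
    ∑ (suc (suc M)) (λ l → sign l * S i l)
      ≡⟨ ∑-head (suc M) (λ l → sign l * S i l) ⟩
    1ℚ * S i 0 + ∑ (suc M) (λ l → - sign l * S i (suc l))
      ≡⟨ cong₂ _+_ (*-identityˡ (S i 0)) (trans
           (∑-cong (suc M) (λ l → sym (neg-distribˡ-* (sign l) (S i (suc l)))))
           (sym (neg-distrib-∑ (suc M) (λ l → sign l * S i (suc l))))) ⟩
    S i 0 - ∑ (suc M) (λ l → sign l * S i (suc l))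
      ≡⟨ cong (λ t → S i 0 - t) (begin
        ∑ (suc M) (λ l → sign l * S i (suc l))
          ≡⟨ ∑-cong (suc M) (λ l → trans (cong (sign l *_) (S-suc d i l e≡))
               (*-distribˡ-∑ d (sign l) (λ e → z e * S (suc i ℕ.+ e) l))) ⟩
        ∑ (suc M) (λ l → ∑ d (λ e → sign l * (z e * S (suc i ℕ.+ e) l)))
          ≡⟨ ∑-comm (suc M) d (λ l e → sign l * (z e * S (suc i ℕ.+ e) l)) ⟩
        ∑ d (λ e → ∑ (suc M) (λ l → sign l * (z e * S (suc i ℕ.+ e) l)))
          ≡⟨ ∑-cong d (λ e → trans
               (∑-cong (suc M) (λ l → solve 3 (λ s z t → s :* (z :* t) := z :* (s :* t)) refl (sign l) (z e) (S (suc i ℕ.+ e) l)))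
               (sym (*-distribˡ-∑ (suc M) (z e) (λ l → sign l * S (suc i ℕ.+ e) l)))) ⟩
        ∑ d (λ e → z e * T M (suc i ℕ.+ e)) ∎) ⟩
    S i 0 - ∑ d (λ e → z e * T M (suc i ℕ.+ e)) ∎
    where
    open ≡-Reasoning
    z : ℕ → ℚ
    z e = zetaN N (reverse (map a (interval i (suc e))))

  -- Splitting chains at their first step gives the recursion of `antipode`, up to the factor
  -- (-1)^d. A chain from i has at most d steps, so d ≤ M loses none.
  T-star : ∀ M i d → i ℕ.+ d ≡ K → d ≤ M → T M i ≡ sign d * zetaStarN N (map a (interval i d))
  T-star zero i zero e≡ z≤n = trans (+-identityˡ (1ℚ * S i 0))
    (cong (1ℚ *_) (S-top i (trans (sym (ℕₚ.+-identityʳ i)) e≡)))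
  T-star (suc M) i zero e≡ z≤n = trans (T-suc M 0 i e≡)
    (cong (_- 0ℚ) (S-top i (trans (sym (ℕₚ.+-identityʳ i)) e≡)))
  T-star (suc M) i (suc d) e≡ (s≤s d≤M) = begin
    T (suc M) i
      ≡⟨ T-suc M (suc d) i e≡ ⟩
    S i 0 - ∑ (suc d) (λ e → z e * T M (suc i ℕ.+ e))
      ≡⟨ cong₂ _-_ (S-below i d e≡) (∑-cong< (suc d) (λ e e<sd → cong (z e *_)
           (T-star M (suc i ℕ.+ e) (d ∸ e) (index e (ℕₚ.≤-pred e<sd)) (ℕₚ.≤-trans (ℕₚ.m∸n≤m d e) d≤M)))) ⟩
    0ℚ - ∑ (suc d) (λ e → z e * (sign (d ∸ e) * zetaStarN N (map a (interval (suc i ℕ.+ e) (d ∸ e)))))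
      ≡⟨ cong (λ t → 0ℚ - t) (trans (∑-cong< (suc d) term) (sym (*-distribˡ-∑ (suc d) (sign d) u))) ⟩
    0ℚ - sign d * ∑ (suc d) u
      ≡⟨ solve 2 (λ s t → con 0ℚ :- s :* t := (:- s) :* t) refl (sign d) (∑ (suc d) u) ⟩
    - sign d * ∑ (suc d) u
      ≡⟨ cong (- sign d *_) (antipode N a d i) ⟨
    - sign d * zetaStarN N (map a (interval i (suc d))) ∎
    where
    open ≡-Reasoning
    z : ℕ → ℚ
    z e = zetaN N (reverse (map a (interval i (suc e))))
    u : ℕ → ℚ
    u e = sign e * (z e * zetaStarN N (map a (interval (i ℕ.+ suc e) (d ∸ e))))
    index : ∀ e → e ≤ d → suc i ℕ.+ e ℕ.+ (d ∸ e) ≡ K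
    index e e≤d = trans (ℕₚ.+-assoc (suc i) e (d ∸ e)) (trans (cong (suc i ℕ.+_) (ℕₚ.m+[n∸m]≡n e≤d))
      (trans (sym (ℕₚ.+-suc i d)) e≡))
    term : ∀ e → e ℕ.< suc d →
      z e * (sign (d ∸ e) * zetaStarN N (map a (interval (suc i ℕ.+ e) (d ∸ e)))) ≡ sign d * u e
    term e e<sd = trans
      (cong₂ (λ s j → z e * (s * zetaStarN N (map a (interval j (d ∸ e)))))
        (sym (sign-∸ (ℕₚ.≤-pred e<sd))) (sym (ℕₚ.+-suc i e)))
      (solve 4 (λ z s t w → z :* ((s :* t) :* w) := s :* (t :* (z :* w))) refl (z e) (sign d) (sign e)
        (zetaStarN N (map a (interval (i ℕ.+ suc e) (d ∸ e)))))

  -- The convention 1 at j = k+1 is the star sum of the empty index. Below k+1 no chain has zero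
  -- steps, so the sum over l ≥ 1 may start at 0.
  innerN-star : ∀ i d → i ℕ.+ d ≡ K → innerN N k m i ≡ sign d * zetaStarN N (map a (interval i d))
  innerN-star i zero e≡ with trans (sym (ℕₚ.+-identityʳ i)) e≡
  ... | refl rewrite ≡ᵇ-refl k = refl
  innerN-star i (suc d) e≡ = trans unfold (trans
    (sym (trans (∑-head (suc d) (λ l → sign l * S i l)) (trans
      (cong (λ t → 1ℚ * t + ∑ (suc d) (λ l → sign (suc l) * S i (suc l))) (S-below i d e≡))
      (+-identityˡ (∑ (suc d) (λ l → sign (suc l) * S i (suc l)))))))
    (T-star (suc d) i (suc d) e≡ ℕₚ.≤-refl))
    where
    unfold : innerN N k m i ≡ ∑ (suc d) (λ l → sign (suc l) * S i (suc l))
    unfold rewrite trans (cong (i ≡ᵇ_) (sym e≡)) (≡ᵇ-+suc i d) =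
      sumFromTo-∑ (suc d) 1 (suc k ∸ i) (λ l → sign l * S i l) (trans (cong (_∸ i) (sym e≡)) (ℕₚ.m+n∸m≡n i (suc d)))

  lhsN-expand : ∀ ks kr → lhsN N ks kr k m ≡
    ∑ (suc k) (λ i → sign i * (zetaN N (primal m ks kr i) * zetaStarN N (map a (interval (suc i) (k ∸ i)))))
  lhsN-expand ks kr = trans (cong (λ l → kyN N ks kr (map a l)) (range-interval k 1 k refl)) (trans
    (sumFromTo-∑ N 1 N (λ n → zetaN (n ∸ 1) R * zetaStarN n ls * invPow (n ∸ 1) (suc kr)) refl) (trans
    (∑-cong N (λ i → trans
      (solve 3 (λ z s p → z :* s :* p := (p :* z) :* s) refl (zetaN i R) (zetaStarN (suc i) ls) (invPow i (suc kr)))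
      (cong (λ t → (invPow i (suc kr) * t) * zetaStarN (suc i) ls) (sym (∑-B i R))))) (trans
    (sym (trans (∑-head N (λ n → B (suc kr ∷ R) n * zetaStarN n ls)) (trans
      (cong (_+ ∑ N (λ i → B (suc kr ∷ R) (suc i) * zetaStarN (suc i) ls)) (*-zeroˡ (zetaStarN 0 ls)))
      (+-identityˡ (∑ N (λ i → B (suc kr ∷ R) (suc i) * zetaStarN (suc i) ls))))))
    (L-expand N a k 1 (suc kr ∷ R)))))
    where
    R = reverse (map suc ks)
    ls = map a (interval 1 k)

  rhsN-expand : ∀ ks kr → rhsN N ks kr k m ≡
    ∑ (suc k) (λ i → sign i * (zetaN N (kV ks kr ++ mV m i) * zetaStarN N (map a (interval (suc i) (k ∸ i)))))
  rhsN-expand ks kr = trans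
    (cong (sign k *_) (sumFromTo-∑ (suc k) 1 (suc k) (λ j → zetaN N (kV ks kr ++ mV m (j ∸ 1)) * innerN N k m j) refl)) (trans
    (*-distribˡ-∑ (suc k) (sign k) (λ i → zetaN N (kV ks kr ++ mV m i) * innerN N k m (suc i)))
    (∑-cong< (suc k) (λ i i<sk → let
      i≤k = ℕₚ.≤-pred i<sk
      Y = zetaN N (kV ks kr ++ mV m i)
      X = zetaStarN N (map a (interval (suc i) (k ∸ i))) in begin
      sign k * (Y * innerN N k m (suc i))
        ≡⟨ cong (λ t → sign k * (Y * t)) (innerN-star (suc i) (k ∸ i) (cong suc (ℕₚ.m+[n∸m]≡n i≤k))) ⟩
      sign k * (Y * (sign (k ∸ i) * X))
        ≡⟨ solve 4 (λ a b c d → a :* (b :* (c :* d)) := (a :* c) :* (b :* d)) refl (sign k) Y (sign (k ∸ i)) X ⟩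
      sign k * sign (k ∸ i) * (Y * X)
        -- The global sign (-1)^k turns (-1)^(k-i) into the (-1)^i of the left side.
        ≡⟨ cong (_* (Y * X)) (trans (sign-∸ (ℕₚ.m∸n≤m k i)) (cong sign (ℕₚ.m∸[m∸n]≡n i≤k))) ⟩
      sign i * (Y * X)                       ∎)))
    where open ≡-Reasoning

  lhsN-rhsN : ∀ ks kr → lhsN N ks kr k m - rhsN N ks kr k m ≡
    ∑ (suc k) (λ i → (sign i * zetaStarN N (map a (interval (suc i) (k ∸ i))))
                     * (zetaN N (primal m ks kr i) - zetaN N (kV ks kr ++ mV m i)))
  lhsN-rhsN ks kr = trans (cong₂ _-_ (lhsN-expand ks kr) (rhsN-expand ks kr)) (trans
    (sym (∑-distrib-- (suc k) _ _))
    (∑-cong (suc k) (λ i → solve 4 (λ s p d w → s :* (p :* w) :- s :* (d :* w) := (s :* w) :* (p :- d)) refl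
      (sign i) (zetaN N (primal m ks kr i)) (zetaN N (kV ks kr ++ mV m i)) (zetaStarN N (map a (interval (suc i) (k ∸ i)))))))

-- Logarithmic growth of star sums

ip≤1 : ∀ n s → ip n s ≤ℚ 1ℚ
ip≤1 zero    s       = 0≤1
ip≤1 (suc n) zero    = ≤-refl
ip≤1 (suc n) (suc s) = subst (_≤ℚ 1ℚ) (sym (ip-suc (suc n) s))
  (*-mono-≤ {rec (suc n)} {1ℚ} {ip (suc n) s} {1ℚ} (rec-nonneg (suc n)) 0≤1 (rec≤1 (suc n)) (ip≤1 (suc n) s))

ip≤rec : ∀ n p → ip n (suc p) ≤ℚ rec n
ip≤rec n p = subst₂ _≤ℚ_ (sym (ip-suc n p)) (*-identityʳ (rec n)) (*-monoˡ-≤ (rec-nonneg n) (ip≤1 n p))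

zetaStarN-nonneg : ∀ n ss → 0ℚ ≤ℚ zetaStarN n ss
zetaStarN-nonneg n []       = 0≤1
zetaStarN-nonneg n (s ∷ ss) = subst (0ℚ ≤ℚ_) (sym (zetaStarN-∑ n s ss))
  (∑-nonneg (suc n) (λ i → *-nonneg (ip-nonneg i s) (zetaStarN-nonneg i ss)))

-- Uniform in n ≤ N, because the inner star sums stop at the outer summation variable.
zetaStarN≤harm : ∀ {N ss} → All (1 ≤_) ss → ∀ {n} → n ≤ N → zetaStarN n ss ≤ℚ harm N ↑ length ss
zetaStarN≤harm [] n≤N = ≤-refl
zetaStarN≤harm {N} {suc p ∷ ss} (_ ∷ ps) {n} n≤N = begin
  zetaStarN n (suc p ∷ ss)                              ≡⟨ zetaStarN-∑ n (suc p) ss ⟩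
  ∑ (suc n) (λ i → ip i (suc p) * zetaStarN i ss)
    ≤⟨ ∑-mono-≤ (suc n) (λ i i<sn → *-mono-≤ (ip-nonneg i (suc p)) H≥0
        (ip≤rec i p) (zetaStarN≤harm ps (ℕₚ.≤-trans (ℕₚ.≤-pred i<sn) n≤N))) ⟩
  ∑ (suc n) (λ i → rec i * H)                           ≡⟨ *-distribʳ-∑ (suc n) H rec ⟨
  ∑ (suc n) rec * H
    ≤⟨ *-monoʳ-≤ H≥0 (≤-trans (∑-mono-bound rec-nonneg (s≤s n≤N)) (∑rec≤harm N)) ⟩
  harm N * H                                            ∎
  where
  open ≤-Reasoning
  H = harm N ↑ length ss
  H≥0 = ↑-nonneg (length ss) (harm-nonneg N)

∣sign∣ : ∀ i → ∣ sign i ∣ ≡ 1ℚ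
∣sign∣ zero    = refl
∣sign∣ (suc i) = trans (∣-p∣≡∣p∣ (sign i)) (∣sign∣ i)

zetaStarN-logBounded : ∀ i {ss} → All (1 ≤_) ss → LogBounded (λ N → sign i * zetaStarN N ss)
zetaStarN-logBounded i {ss} ps = length ss , λ N → let ζ = zetaStarN N ss in begin
  ∣ sign i * ζ ∣          ≡⟨ ∣p*q∣≡∣p∣*∣q∣ (sign i) ζ ⟩
  ∣ sign i ∣ * ∣ ζ ∣      ≡⟨ cong₂ _*_ (∣sign∣ i) (0≤p⇒∣p∣≡p (zetaStarN-nonneg N ss)) ⟩
  1ℚ * ζ                  ≡⟨ *-identityˡ ζ ⟩
  ζ                       ≤⟨ zetaStarN≤harm ps ℕₚ.≤-refl ⟩
  harm N ↑ length ss      ∎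
  where open ≤-Reasoning

-- Words of an index and of its dual

infixr 8 _^ʷ_
_^ʷ_ : Letter → ℕ → Word
c ^ʷ n = replicate n c

word : List ℕ → Word
word []       = []
word (s ∷ ss) = x ^ʷ (s ∸ 1) ++ y ∷ word ss

A-block : ∀ p w n → A (x ^ʷ p ++ y ∷ w) n ≡ ip n (suc p) * ∑ n (A w)
A-block zero    w n = refl
A-block (suc p) w n = trans (cong (rec n *_) (A-block p w n))
  (trans (sym (*-assoc (rec n) (ip n (suc p)) (∑ n (A w)))) (cong (_* ∑ n (A w)) (sym (ip-suc n (suc p)))))

-- Positivity matters: `word` gives an entry 0 the same block as an entry 1.
B-A : ∀ {ss} → All (1 ≤_) ss → ∀ n → B ss n ≡ A (word ss) n
B-A []                    n = refl
B-A {suc p ∷ ss} (_ ∷ ps) n = trans (cong (ip n (suc p) *_) (∑-cong n (B-A ps))) (sym (A-block p (word ss) n))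

zetaN-zetaW : ∀ {ss} → All (1 ≤_) ss → ∀ N → zetaN N ss ≡ zetaW N (word ss)
zetaN-zetaW {ss} ps N = trans (sym (∑-B N ss)) (∑-cong (suc N) (B-A ps))

word-++ : ∀ ss ts → word (ss ++ ts) ≡ word ss ++ word ts
word-++ []       ts = refl
word-++ (s ∷ ss) ts = trans (cong (λ w → x ^ʷ (s ∸ 1) ++ y ∷ w) (word-++ ss ts))
  (sym (Listₚ.++-assoc (x ^ʷ (s ∸ 1)) (y ∷ word ss) (word ts)))

word-ones : ∀ d → word (ones d) ≡ y ^ʷ d
word-ones zero    = refl
word-ones (suc d) = cong (y ∷_) (word-ones d)

replicate-shift : ∀ n (c : Letter) w → c ^ʷ n ++ c ∷ w ≡ c ^ʷ suc n ++ w
replicate-shift zero    c w = refl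
replicate-shift (suc n) c w = cong (c ∷_) (replicate-shift n c w)

-- The dual of x^q y is x y^q. A block with q = 0 is a bare x that joins the next block, which is
-- the box convention.
dualBlocks : List ℕ → Word
dualBlocks = concatMap (λ q → x ∷ y ^ʷ q)

dualOnto-xs : ∀ p w v → dualOnto (x ^ʷ p ++ w) v ≡ dualOnto w (y ^ʷ p ++ v)
dualOnto-xs zero    w v = refl
dualOnto-xs (suc p) w v = trans (dualOnto-xs p w (y ∷ v)) (cong (dualOnto w) (replicate-shift p y v))

dualOnto-word : ∀ ps v → dualOnto (word (map suc ps)) v ≡ dualBlocks (reverse ps) ++ v
dualOnto-word []       v = refl
dualOnto-word (p ∷ ps) v = begin
  dualOnto (x ^ʷ p ++ y ∷ word (map suc ps)) v             ≡⟨ dualOnto-xs p (y ∷ word (map suc ps)) v ⟩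
  dualOnto (word (map suc ps)) (x ∷ y ^ʷ p ++ v)           ≡⟨ dualOnto-word ps (x ∷ y ^ʷ p ++ v) ⟩
  dualBlocks (reverse ps) ++ (x ∷ y ^ʷ p) ++ v
    ≡⟨ Listₚ.++-assoc (dualBlocks (reverse ps)) (x ∷ y ^ʷ p) v ⟨
  (dualBlocks (reverse ps) ++ (x ∷ y ^ʷ p)) ++ v
    ≡⟨ cong (λ t → (dualBlocks (reverse ps) ++ t) ++ v) (Listₚ.++-identityʳ (x ∷ y ^ʷ p)) ⟨
  (dualBlocks (reverse ps) ++ dualBlocks (p ∷ [])) ++ v
    ≡⟨ cong (_++ v) (Listₚ.concatMap-++ (λ q → x ∷ y ^ʷ q) (reverse ps) (p ∷ [])) ⟨
  dualBlocks (reverse ps ++ p ∷ []) ++ v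
    ≡⟨ cong (λ t → dualBlocks t ++ v) (Listₚ.unfold-reverse p ps) ⟨
  dualBlocks (reverse (p ∷ ps)) ++ v                       ∎
  where open ≡-Reasoning

-- The open entry u+1 stands for x^u, the last x of which belongs to the next dual block; the extra
-- x on the left avoids the exponent u-1. The y of the final entry and the r trailing ones form
-- y^(r+1).
word-boxAux : ∀ u ks r → x ∷ word (boxAux (suc u) ks) ++ y ^ʷ r ≡ x ^ʷ u ++ dualBlocks (ks ++ suc r ∷ [])
word-boxAux u []           r = begin
  x ∷ (x ^ʷ u ++ y ∷ []) ++ y ^ʷ r        ≡⟨ cong (x ∷_) (Listₚ.++-assoc (x ^ʷ u) (y ∷ []) (y ^ʷ r)) ⟩
  x ∷ x ^ʷ u ++ y ^ʷ suc r                ≡⟨ replicate-shift u x (y ^ʷ suc r) ⟨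
  x ^ʷ u ++ x ∷ y ^ʷ suc r                ≡⟨ cong (x ^ʷ u ++_) (Listₚ.++-identityʳ (x ∷ y ^ʷ suc r)) ⟨
  x ^ʷ u ++ (x ∷ y ^ʷ suc r) ++ []        ∎
  where open ≡-Reasoning
word-boxAux u (zero ∷ ks)  r = trans (word-boxAux (suc u) ks r) (sym (replicate-shift u x (dualBlocks (ks ++ suc r ∷ []))))
word-boxAux u (suc q ∷ ks) r = begin
  x ∷ (x ^ʷ u ++ y ∷ word (ones q ++ boxAux 2 ks)) ++ y ^ʷ r
    ≡⟨ cong (x ∷_) (Listₚ.++-assoc (x ^ʷ u) (y ∷ word (ones q ++ boxAux 2 ks)) (y ^ʷ r)) ⟩
  x ∷ x ^ʷ u ++ y ∷ word (ones q ++ boxAux 2 ks) ++ y ^ʷ r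
    ≡⟨ replicate-shift u x _ ⟨
  x ^ʷ u ++ x ∷ y ∷ word (ones q ++ boxAux 2 ks) ++ y ^ʷ r
    ≡⟨ cong (λ t → x ^ʷ u ++ x ∷ y ∷ t ++ y ^ʷ r) (trans (word-++ (ones q) (boxAux 2 ks)) (cong (_++ word (boxAux 2 ks)) (word-ones q))) ⟩
  x ^ʷ u ++ x ∷ y ∷ (y ^ʷ q ++ word (boxAux 2 ks)) ++ y ^ʷ r
    ≡⟨ cong (λ t → x ^ʷ u ++ x ∷ y ∷ t) (Listₚ.++-assoc (y ^ʷ q) (word (boxAux 2 ks)) (y ^ʷ r)) ⟩
  x ^ʷ u ++ x ∷ y ∷ y ^ʷ q ++ word (boxAux 2 ks) ++ y ^ʷ r
    ≡⟨ cong (λ t → x ^ʷ u ++ x ∷ y ∷ y ^ʷ q ++ t) (Listₚ.∷-injectiveʳ (word-boxAux 1 ks r)) ⟩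
  x ^ʷ u ++ dualBlocks (suc q ∷ ks ++ suc r ∷ []) ∎
  where open ≡-Reasoning

word-kV : ∀ ks r → word (kV ks (suc r)) ≡ dualBlocks (ks ++ suc r ∷ [])
word-kV ks r = trans (trans (word-++ (boxAux 2 ks) (ones r)) (cong (word (boxAux 2 ks) ++_) (word-ones r)))
  (Listₚ.∷-injectiveʳ (word-boxAux 1 ks r))

word-twoOnes : ∀ (m : ℕ → ℕ) {is} → All (λ i → 1 ≤ m i) is →
  word (concatMap (λ i → 2 ∷ ones (m i ∸ 1)) is) ≡ dualBlocks (map m is)
word-twoOnes m []                 = refl
word-twoOnes m {i ∷ is} (1≤mi ∷ ps) = begin
  x ∷ y ∷ word (ones (m i ∸ 1) ++ rest)
    ≡⟨ cong (λ w → x ∷ y ∷ w) (word-++ (ones (m i ∸ 1)) rest) ⟩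
  x ∷ y ∷ word (ones (m i ∸ 1)) ++ word rest
    ≡⟨ cong₂ (λ u v → x ∷ y ∷ u ++ v) (word-ones (m i ∸ 1)) (word-twoOnes m ps) ⟩
  x ∷ y ^ʷ suc (m i ∸ 1) ++ dualBlocks (map m is)
    ≡⟨ cong (λ q → x ∷ y ^ʷ q ++ dualBlocks (map m is)) (ℕₚ.m+[n∸m]≡n 1≤mi) ⟩
  x ∷ y ^ʷ m i ++ dualBlocks (map m is)           ∎
  where
  open ≡-Reasoning
  rest = concatMap (λ i → 2 ∷ ones (m i ∸ 1)) is

ones-positive : ∀ d → All (1 ≤_) (ones d)
ones-positive d = Allₚ.replicate⁺ d (s≤s z≤n)

boxAux-positive : ∀ u ks → All (1 ≤_) (boxAux (suc u) ks)
boxAux-positive u []           = s≤s z≤n ∷ []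
boxAux-positive u (zero ∷ ks)  = boxAux-positive (suc u) ks
boxAux-positive u (suc q ∷ ks) = s≤s z≤n ∷ Allₚ.++⁺ (ones-positive q) (boxAux-positive 1 ks)

twoOnes-positive : ∀ (m : ℕ → ℕ) is → All (1 ≤_) (concatMap (λ i → 2 ∷ ones (m i ∸ 1)) is)
twoOnes-positive m []       = []
twoOnes-positive m (i ∷ is) = s≤s z≤n ∷ Allₚ.++⁺ (ones-positive (m i ∸ 1)) (twoOnes-positive m is)

word-endsInY : ∀ p ps → EndsInY (x ^ʷ p ++ y ∷ word ps)
word-endsInY (suc p) ps       = x ∷ word-endsInY p ps
word-endsInY zero    []       = [y]
word-endsInY zero    (q ∷ ps) = y ∷ word-endsInY (q ∸ 1) ps

-- Admissibility of the primal index: before the shift by one its first entry is m_i, or k_r if i =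
-- 0, hence positive.
reverse-++-head : ∀ {ms} → All (1 ≤_) ms → ∀ q R → ∃ λ p → ∃ λ ps → reverse ms ++ suc q ∷ R ≡ suc p ∷ ps
reverse-++-head [] q R = q , R , refl
reverse-++-head {suc t ∷ ms} (_ ∷ 1≤ms) q R with reverse-++-head 1≤ms t (suc q ∷ R)
... | p , ps , e = p , ps , trans (trans (cong (_++ suc q ∷ R) (Listₚ.unfold-reverse (suc t) ms))
  (Listₚ.++-assoc (reverse ms) (suc t ∷ []) (suc q ∷ R))) e

interval-All : ∀ {P : ℕ → Set} c j → (∀ i → j ≤ i → i ℕ.< j ℕ.+ c → P i) → All P (interval j c)
interval-All zero    j p = []
interval-All (suc c) j p = p j ℕₚ.≤-refl (ℕₚ.m<m+n j (s≤s z≤n)) ∷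
  interval-All c (suc j) (λ i j<i i< → p i (ℕₚ.<⇒≤ j<i) (subst (i ℕ.<_) (sym (ℕₚ.+-suc j c)) i<))

duality-index : ∀ p ps →
  (λ N → zetaN N (map suc (suc p ∷ ps))) ≈ (λ N → zetaW N (dualBlocks (reverse (suc p ∷ ps))))
duality-index p ps = ≈-resp
  (λ N → sym (zetaN-zetaW positive-entries N))
  (λ N → cong (zetaW N) (trans (dualOnto-word (suc p ∷ ps) []) (Listₚ.++-identityʳ _)))
  (duality (word-endsInY p (map suc ps)))
  where
  positive-entries : All (1 ≤_) (map suc (suc p ∷ ps))
  positive-entries = Allₚ.map⁺ (All.universal (λ _ → s≤s z≤n) (suc p ∷ ps))

-- The dual pairs of the theorem

module _ (m : ℕ → ℕ) (ks : List ℕ) (r i : ℕ) (1≤m : ∀ t → 1 ≤ t → t ≤ i → 1 ≤ m t) where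

  private
    is = interval 1 i
    kr = suc r

    1≤m-interval : All (λ t → 1 ≤ m t) is
    1≤m-interval = interval-All i 1 (λ t 1≤t t<1+i → 1≤m t 1≤t (ℕₚ.≤-pred t<1+i))

    mV-interval : mV m i ≡ concatMap (λ t → 2 ∷ ones (m t ∸ 1)) is
    mV-interval = cong (concatMap (λ t → 2 ∷ ones (m t ∸ 1))) (range-interval i 1 i refl)

  dual-word : word (kV ks kr ++ mV m i) ≡ dualBlocks (ks ++ kr ∷ map m is)
  dual-word = begin
    word (kV ks kr ++ mV m i)                          ≡⟨ word-++ (kV ks kr) (mV m i) ⟩
    word (kV ks kr) ++ word (mV m i)
      ≡⟨ cong₂ _++_ (word-kV ks r) (trans (cong word mV-interval) (word-twoOnes m 1≤m-interval)) ⟩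
    dualBlocks (ks ++ kr ∷ []) ++ dualBlocks (map m is)
      ≡⟨ Listₚ.concatMap-++ (λ q → x ∷ y ^ʷ q) (ks ++ kr ∷ []) (map m is) ⟨
    dualBlocks ((ks ++ kr ∷ []) ++ map m is)
      ≡⟨ cong dualBlocks (Listₚ.++-assoc ks (kr ∷ []) (map m is)) ⟩
    dualBlocks (ks ++ kr ∷ map m is)                   ∎
    where open ≡-Reasoning

  dual-positive : All (1 ≤_) (kV ks kr ++ mV m i)
  dual-positive = Allₚ.++⁺ (Allₚ.++⁺ (boxAux-positive 1 ks) (ones-positive r))
    (subst (All (1 ≤_)) (sym mV-interval) (twoOnes-positive m is))

  primal-map-suc : primal m ks kr i ≡ map suc (reverse (map m is) ++ kr ∷ reverse ks)
  primal-map-suc = sym (trans (Listₚ.map-++ suc (reverse (map m is)) (kr ∷ reverse ks)) (cong₂ (λ u v → u ++ suc kr ∷ v)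
    (trans (Listₚ.reverse-map suc (map m is)) (cong reverse (sym (Listₚ.map-∘ is)))) (Listₚ.reverse-map suc ks)))

  reverse-primal : reverse (reverse (map m is) ++ kr ∷ reverse ks) ≡ ks ++ kr ∷ map m is
  reverse-primal = begin
    reverse (reverse (map m is) ++ kr ∷ reverse ks)
      ≡⟨ Listₚ.reverse-++ (reverse (map m is)) (kr ∷ reverse ks) ⟩
    reverse (kr ∷ reverse ks) ++ reverse (reverse (map m is))  ≡⟨ cong₂ _++_
        (trans (Listₚ.unfold-reverse kr (reverse ks)) (cong (_++ kr ∷ []) (Listₚ.reverse-involutive ks))) (Listₚ.reverse-involutive (map m is)) ⟩
    (ks ++ kr ∷ []) ++ map m is
      ≡⟨ Listₚ.++-assoc ks (kr ∷ []) (map m is) ⟩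
    ks ++ kr ∷ map m is                                        ∎
    where open ≡-Reasoning

  -- The primal index runs from m_i down to k_1. Duality reverses it to k_1, ..., k_r, m_1, ...,
  -- m_i, the order in which `kV` and `mV` list their blocks.
  primal≈dual : (λ N → zetaN N (primal m ks kr i)) ≈ (λ N → zetaN N (kV ks kr ++ mV m i))
  primal≈dual with reverse-++-head (Allₚ.map⁺ 1≤m-interval) r (reverse ks)
  ... | p , ps , e = ≈-resp
    (λ N → cong (zetaN N) (sym (trans primal-map-suc (cong (map suc) e))))
    (λ N → trans (cong (zetaW N) (trans (cong dualBlocks (trans (cong reverse (sym e)) reverse-primal)) (sym dual-word)))
      (sym (zetaN-zetaW dual-positive N)))
    (duality-index p ps)

theorem5p5 : (k : ℕ) → 1 ≤ k → (m : ℕ → ℕ) → (∀ i → 1 ≤ i → i ≤ k → 1 ≤ m i) →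
    (ks : List ℕ) → (kr : ℕ) → 1 ≤ kr →
    (ε : ℚ) → 0ℚ < ε → ∃ λ N₀ → ∀ N → N ≥ N₀ →
    ∣ lhsN N ks kr k m - rhsN N ks kr k m ∣ ≤ℚ ε
theorem5p5 k _ m 1≤m ks (suc r) _ = Negligible⇒null (Negligible-resp
  (λ N → sym (Truncated.lhsN-rhsN N k m ks (suc r)))
  (Negligible-∑ (suc k) (λ i i<1+k → Negligible-*
    (zetaStarN-logBounded i (Allₚ.map⁺ (All.universal (λ _ → s≤s z≤n) (interval (suc i) (k ∸ i)))))
    (negligible-difference (primal≈dual m ks r i (λ t 1≤t t≤i → 1≤m t 1≤t (ℕₚ.≤-trans t≤i (ℕₚ.≤-pred i<1+k))))))))
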